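{- Let $\overrightarrow{F}$ be the oriented graph on vertices $x,y_1,y_2,z$ with arcs $\overrightarrow{xy_1},\overrightarrow{xy_2},\overrightarrow{y_1z},\overrightarrow{y_2z}$. Then for all sufficiently large $n$, $\mathrm{ex}_{\mathrm{ori}}(n,\overrightarrow{F})=\lfloor n^2/4\rfloor+\lceil n/2\rceil$.
   Context: An oriented graph is a directed graph with no loops, no multiple arcs and no pair of opposite arcs. $\mathrm{ex}_{\mathrm{ori}}(n,\overrightarrow{F})$ is the largest number of arcs in an $n$-vertex oriented graph not containing $\overrightarrow{F}$ as a (not necessarily induced) subgraph. -}

module Defs where

open import Data.Nat using (ℕ; _≤_)
open import Data.Bool using (Bool; true; false)
open import Data.Fin using (Fin)
open import Data.List using (List; map; length; filter)
open import Data.Nat.ListAction using (sum)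
open import Data.List using () renaming (allFin to allFinL)
open import Data.Product using (_×_; ∃-syntax)
open import Relation.Binary.PropositionalEquality using (_≡_; _≢_)
open import Relation.Nullary using (¬_)
open import Data.Bool.Properties using (T?)
open import Data.Bool using (T)

-- A digraph on vertex set Fin n, given by its (decidable) arc relation:
-- arc u v ≡ true  means there is an arc u → v.  Multiple arcs are impossible
-- by construction.
Digraph : ℕ → Set
Digraph n = Fin n → Fin n → Bool

IsOriented : ∀ {n} → Digraph n → Set
IsOriented {n} G =
  ((u : Fin n) → G u u ≡ false) ×
  ((u v : Fin n) → G u v ≡ true → G v u ≡ false)

arcCount : ∀ {n} → Digraph n → ℕ
arcCount {n} G =
  sum (map (λ u → length (filter (λ v → T? (G u v)) (allFinL n))) (allFinL n))

ContainsF : ∀ {n} → Digraph n → Set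
ContainsF {n} G =
  ∃[ x ] ∃[ y₁ ] ∃[ y₂ ] ∃[ z ]
    ( (x ≢ y₁) × (x ≢ y₂) × (x ≢ z) × (y₁ ≢ y₂) × (y₁ ≢ z) × (y₂ ≢ z)
    × G x y₁ ≡ true × G x y₂ ≡ true × G y₁ z ≡ true × G y₂ z ≡ true )

ExOriF≡ : ℕ → ℕ → Set
ExOriF≡ n m =
  (∃[ G ] (IsOriented {n} G × ¬ ContainsF G × arcCount G ≡ m)) ×
  ((G : Digraph n) → IsOriented G → ¬ ContainsF G → arcCount G ≤ m)

{-# OPTIONS --safe #-}
module Submission where

open import Defs
open import Data.Nat using (ℕ; zero; suc; _+_; _*_; _∸_; _/_; _≥_; _≤_; _<_; z≤n; s≤s; _≤?_; _<ᵇ_)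
open import Data.Nat.Properties hiding (_≟_)
open import Data.Nat.ListAction using () renaming (sum to listSum)
open import Data.Nat.DivMod using (m*n/n≡m; +-distrib-/-∣ʳ)
open import Data.Nat.Divisibility using (n∣m*n)
open import Data.Nat.Tactic.RingSolver using (solve)
open import Data.Bool using (Bool; true; false; _∧_; _∨_; not; if_then_else_)
open import Data.Fin using (Fin; zero; suc; toℕ)
open import Data.Fin.Properties using (_≟_; any?)
open import Data.List using ([]; _∷_; tabulate; length; filter; map; allFin)
open import Data.Product using (∃-syntax; _×_; _,_; proj₁; proj₂)
open import Data.Sum using (_⊎_; inj₁; inj₂)
open import Data.Empty using (⊥; ⊥-elim)
open import Function using (_∘_)
open import Relation.Nullary using (¬_; ¬?; yes; no; does; contradiction)
open import Relation.Nullary.Decidable using (_×-dec_; isYes; dec-false)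
open import Relation.Binary.PropositionalEquality
open import Algebra.Properties.Semiring.Sum +-*-semiring
  using (∑-distrib-+; ∑-comm; *-distribˡ-sum; *-distribʳ-sum; sum-cong-≗)
  renaming (sum to ∑)
open import Data.Bool.Properties using (T?)
import Data.Bool.Properties as Bool

-- Let G have no diamond, let y have maximal indegree D, X = N⁻(y) and W = V ∖ X.
-- No vertex has two out-neighbours in X, since both would lie on 2-paths to y.
-- Let P be the set of vertices having one, and d the total deficiency
-- Σ_{w ∈ W} (D − d⁻(w)).  Counting arcs by their heads gives
--   arcs + d = D |W| + |P|,
-- so more than ⌊(n+1)²/4⌋ = max (s+1)(n−s) arcs force |P| − d > max(|X|, |W|).
-- Hence d is smaller than both |P ∩ X| and |P ∩ W|, and some w ∈ W ∩ P has
-- full indegree D.  Such a w sends an arc to some f ∈ X, so f → w is missing, and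
-- w must be compensated by an in-neighbour u ∈ W.  Each v → u → w with v → x ∈ X
-- then forces x → w to be missing.  Either every vertex has at most one
-- in-neighbour in W, and then these forced non-arcs exceed the deficiency
-- available; or two vertices of W with a common out-neighbour have disjoint
-- in-neighbourhoods, so d ≥ D − 6, almost all of W has full indegree, and the
-- 2-paths ending in X are too many.

-- Linear inequalities and Boolean indicators

abstract
  -- A certificate for x ≤ y given s ≤ t, namely y − x = (t − s) + slack;
  -- stated with the subtractions moved across.
  linear : ∀ {s t x y} slack → s ≤ t → x + t + slack ≡ y + s → x ≤ y
  linear {s} {t} {x} {y} k s≤t eq = +-cancelʳ-≤ t x y (begin
    x + t     ≤⟨ m≤m+n (x + t) k ⟩
    x + t + k ≡⟨ eq ⟩
    y + s     ≤⟨ +-monoʳ-≤ y s≤t ⟩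
    y + t     ∎)
    where open ≤-Reasoning

scale : ∀ k {s t} → s ≤ t → k * s ≤ k * t
scale k = *-monoʳ-≤ k

absurd : ∀ {A : Set} {x} → suc x ≤ x → A
absurd p = ⊥-elim (1+n≰n p)

true-or-false : ∀ b → b ≡ true ⊎ b ≡ false
true-or-false true  = inj₁ refl
true-or-false false = inj₂ refl

true≢false : ∀ {A : Set} {b} → b ≡ true → b ≡ false → A
true≢false refl ()

∧-intro : ∀ {a b} → a ≡ true → b ≡ true → a ∧ b ≡ true
∧-intro refl refl = refl

∧-elim : ∀ {a b} → a ∧ b ≡ true → a ≡ true × b ≡ true
∧-elim {true} {true} _ = refl , refl

not-intro : ∀ {a} → a ≡ false → not a ≡ true
not-intro refl = refl

not-elim : ∀ {a} → not a ≡ true → a ≡ false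
not-elim {false} _ = refl

⟦_⟧ : Bool → ℕ
⟦ true ⟧  = 1
⟦ false ⟧ = 0

⟦⟧≤1 : ∀ b → ⟦ b ⟧ ≤ 1
⟦⟧≤1 true  = ≤-refl
⟦⟧≤1 false = z≤n

⟦∧⟧ : ∀ a b → ⟦ a ∧ b ⟧ ≡ ⟦ a ⟧ * ⟦ b ⟧
⟦∧⟧ true  b = sym (*-identityˡ _)
⟦∧⟧ false b = refl

⟦not⟧ : ∀ b → ⟦ b ⟧ + ⟦ not b ⟧ ≡ 1
⟦not⟧ true  = refl
⟦not⟧ false = refl

⟦⟧-true : ∀ {b} → b ≡ true → ⟦ b ⟧ ≡ 1
⟦⟧-true refl = refl

⟦⟧-split : ∀ a b → ⟦ a ∧ b ⟧ + ⟦ a ∧ not b ⟧ ≡ ⟦ a ⟧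
⟦⟧-split true  b = ⟦not⟧ b
⟦⟧-split false b = refl

⟦⟧-mono : ∀ {a b} → (a ≡ true → b ≡ true) → ⟦ a ⟧ ≤ ⟦ b ⟧
⟦⟧-mono {true}  {b} f rewrite f refl = ≤-refl
⟦⟧-mono {false} {b} f = z≤n

⟦⟧-disjoint : ∀ {a b} → (a ≡ true → ¬ b ≡ true) → ⟦ a ⟧ + ⟦ b ⟧ ≤ 1
⟦⟧-disjoint {false} {b}     _ = ⟦⟧≤1 b
⟦⟧-disjoint {true}  {false} _ = ≤-refl
⟦⟧-disjoint {true}  {true}  f = contradiction refl (f refl)

⟦⟧-≤-+ : ∀ {a b c} → (a ≡ true → b ≡ true ⊎ c ≡ true) → ⟦ a ⟧ ≤ ⟦ b ⟧ + ⟦ c ⟧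
⟦⟧-≤-+ {false} f = z≤n
⟦⟧-≤-+ {true} {b} {c} f with f refl
... | inj₁ refl = s≤s z≤n
... | inj₂ refl = m≤n+m 1 ⟦ b ⟧

-- Finite sums of natural numbers

private variable n : ℕ

∑-mono : {f g : Fin n → ℕ} → (∀ i → f i ≤ g i) → ∑ f ≤ ∑ g
∑-mono {zero}  f≤g = z≤n
∑-mono {suc n} f≤g = +-mono-≤ (f≤g zero) (∑-mono (f≤g ∘ suc))

∑-const : ∀ n c → ∑ {n} (λ _ → c) ≡ n * c
∑-const zero    c = refl
∑-const (suc n) c = cong (c +_) (∑-const n c)

∑-zero : ∀ n → ∑ {n} (λ _ → 0) ≡ 0
∑-zero n = trans (∑-const n 0) (*-zeroʳ n)

∑-mono₁₂ : {f g h : Fin n → ℕ} → (∀ i → f i ≤ g i + h i) → ∑ f ≤ ∑ g + ∑ h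
∑-mono₁₂ {g = g} {h} p = ≤-trans (∑-mono p) (≤-reflexive (∑-distrib-+ g h))

∑-mono₁₃ : {f g h k : Fin n → ℕ} → (∀ i → f i ≤ g i + h i + k i) → ∑ f ≤ ∑ g + ∑ h + ∑ k
∑-mono₁₃ {g = g} {h} {k} p =
  ≤-trans (∑-mono₁₂ {g = λ i → g i + h i} p) (+-monoˡ-≤ (∑ k) (≤-reflexive (∑-distrib-+ g h)))

∑-< : {f g : Fin n → ℕ} → ∑ f < ∑ g → ∃[ i ] f i < g i
∑-< {f = f} {g} lt with any? (λ i → suc (f i) ≤? g i)
... | yes found = found
... | no none = absurd (≤-trans lt (∑-mono λ i → ≮⇒≥ λ fi<gi → none (i , fi<gi)))

erase : Fin n → (Fin n → ℕ) → Fin n → ℕ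
erase i f k = if does (k ≟ i) then 0 else f k

∑-erase : ∀ (i : Fin n) f → ∑ f ≡ f i + ∑ (erase i f)
∑-erase zero    f = refl
∑-erase (suc i) f = begin
  f zero + ∑ (f ∘ suc)                             ≡⟨ cong (f zero +_) (∑-erase i (f ∘ suc)) ⟩
  f zero + (f (suc i) + ∑ (erase i (f ∘ suc)))     ≡⟨ +-assoc (f zero) _ _ ⟨
  f zero + f (suc i) + ∑ (erase i (f ∘ suc))       ≡⟨ cong (_+ ∑ (erase i (f ∘ suc))) (+-comm (f zero) _) ⟩
  f (suc i) + f zero + ∑ (erase i (f ∘ suc))       ≡⟨ +-assoc (f (suc i)) _ _ ⟩
  f (suc i) + (f zero + ∑ (erase i (f ∘ suc)))     ∎
  where open ≡-Reasoning

erase-≢ : ∀ {i k : Fin n} f → k ≢ i → erase i f k ≡ f k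
erase-≢ {i = i} {k} f k≢i rewrite dec-false (k ≟ i) k≢i = refl

erase-mono : ∀ (i : Fin n) f g k → (k ≢ i → f k ≤ g k) → erase i f k ≤ erase i g k
erase-mono i f g k p with k ≟ i
... | yes _  = z≤n
... | no k≢i = p k≢i

-- The comparison may fail at `i`, so the two values there change sides. Addition is used because
-- truncated subtraction would lose information.
∑-mono-except₁ : ∀ (i : Fin n) {f g} → (∀ k → k ≢ i → f k ≤ g k) → ∑ f + g i ≤ ∑ g + f i
∑-mono-except₁ i {f} {g} p
  rewrite ∑-erase i f | ∑-erase i g =
  let F = f i; G = g i; A = ∑ (erase i f); B = ∑ (erase i g) in
  linear {A} {B} 0 (∑-mono λ k → erase-mono i f g k (p k)) (swap F G A B)
  where
  swap : ∀ F G A B → F + A + G + B + 0 ≡ G + B + F + A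
  swap F G A B = solve (F ∷ G ∷ A ∷ B ∷ [])

∑-mono-except₂ : ∀ {i j : Fin n} {f g} → i ≢ j → (∀ k → k ≢ i → k ≢ j → f k ≤ g k) →
                 ∑ f + (g i + g j) ≤ ∑ g + (f i + f j)
∑-mono-except₂ {i = i} {j} {f} {g} i≢j p
  rewrite ∑-erase i f | ∑-erase i g = helper (f i) (f j) (g i) (g j)
    (subst₂ (λ u v → ∑ (erase i f) + u ≤ ∑ (erase i g) + v)
      (erase-≢ g (i≢j ∘ sym)) (erase-≢ f (i≢j ∘ sym))
      (∑-mono-except₁ j {erase i f} {erase i g} λ k k≢j → erase-mono i f g k λ k≢i → p k k≢i k≢j))
  where
  helper : ∀ F F′ G G′ {A B} → A + G′ ≤ B + F′ → F + A + (G + G′) ≤ G + B + (F + F′)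
  helper F F′ G G′ {A} {B} h = linear 0 h (solve (F ∷ F′ ∷ G ∷ G′ ∷ A ∷ B ∷ []))

term≤∑ : ∀ (i : Fin n) f → f i ≤ ∑ f
term≤∑ i f rewrite ∑-erase i f = m≤m+n _ _

∑-three : ∀ {i j k : Fin n} f → i ≢ j → i ≢ k → j ≢ k → f i + f j + f k ≤ ∑ f
∑-three {i = i} {j} {k} f i≢j i≢k j≢k = begin
  f i + f j + f k                    ≡⟨ +-assoc (f i) _ _ ⟩
  f i + (f j + f k)
    ≡⟨ cong₂ (λ u v → f i + (u + v)) (erase-≢ f (i≢j ∘ sym))
         (trans (erase-≢ (erase i f) (j≢k ∘ sym)) (erase-≢ f (i≢k ∘ sym))) ⟨
  f i + (erase i f j + erase j (erase i f) k)
    ≤⟨ +-monoʳ-≤ (f i) (+-monoʳ-≤ (erase i f j) (term≤∑ k (erase j (erase i f)))) ⟩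
  f i + (erase i f j + ∑ (erase j (erase i f)))  ≡⟨ cong (f i +_) (∑-erase j (erase i f)) ⟨
  f i + ∑ (erase i f)                ≡⟨ ∑-erase i f ⟨
  ∑ f                                ∎
  where open ≤-Reasoning

-- Cardinalities of subsets

count : (Fin n → Bool) → ℕ
count A = ∑ λ i → ⟦ A i ⟧

count-split : ∀ (A B : Fin n → Bool) → count (λ i → A i ∧ B i) + count (λ i → A i ∧ not (B i)) ≡ count A
count-split A B = trans (sym (∑-distrib-+ (λ i → ⟦ A i ∧ B i ⟧) _))
                        (sum-cong-≗ λ i → ⟦⟧-split (A i) (B i))

count-not : ∀ (A : Fin n → Bool) → count A + count (not ∘ A) ≡ n
count-not {n} A = begin
  count A + count (not ∘ A)      ≡⟨ ∑-distrib-+ (λ i → ⟦ A i ⟧) _ ⟨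
  ∑ (λ i → ⟦ A i ⟧ + ⟦ not (A i) ⟧) ≡⟨ sum-cong-≗ (λ i → ⟦not⟧ (A i)) ⟩
  ∑ {n} (λ _ → 1)                ≡⟨ ∑-const n 1 ⟩
  n * 1                          ≡⟨ *-identityʳ n ⟩
  n                              ∎
  where open ≡-Reasoning

abstract
  count>0 : ∀ {A : Fin n → Bool} → 1 ≤ count A → ∃[ i ] A i ≡ true
  count>0 {n} {A} p with ∑-< {f = λ _ → 0} (≤-trans (s≤s (≤-reflexive (∑-zero n))) p)
  ... | i , q with A i in eq
  ...   | true = i , eq

  count-avoid₁ : ∀ {A : Fin n → Bool} i → 2 ≤ count A → ∃[ j ] A j ≡ true × j ≢ i
  count-avoid₁ {n} {A} i p with any? (λ j → (A j Bool.≟ true) ×-dec ¬? (j ≟ i))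
  ... | yes found = found
  ... | no none = absurd (≤-trans p (≤-trans (m≤m+n _ 0) (≤-trans
    (∑-mono-except₁ i {g = λ _ → 0} λ j j≢i → off j j≢i (A j) refl)
    (+-mono-≤ (≤-reflexive (∑-zero n)) (⟦⟧≤1 (A i))))))
    where
    off : ∀ j → j ≢ i → ∀ b → A j ≡ b → ⟦ b ⟧ ≤ 0
    off j j≢i true  eq = ⊥-elim (none (j , eq , j≢i))
    off j j≢i false eq = z≤n

  count-avoid₂ : ∀ {A : Fin n → Bool} {i k} → i ≢ k → 3 ≤ count A → ∃[ j ] A j ≡ true × j ≢ i × j ≢ k
  count-avoid₂ {n} {A} {i} {k} i≢k p
    with any? (λ j → (A j Bool.≟ true) ×-dec (¬? (j ≟ i) ×-dec ¬? (j ≟ k)))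
  ... | yes found = found
  ... | no none = absurd (≤-trans p (≤-trans (m≤m+n _ 0) (≤-trans
    (∑-mono-except₂ {g = λ _ → 0} i≢k λ j j≢i j≢k → off j j≢i j≢k (A j) refl)
    (+-mono-≤ (≤-reflexive (∑-zero n)) (+-mono-≤ (⟦⟧≤1 (A i)) (⟦⟧≤1 (A k)))))))
    where
    off : ∀ j → j ≢ i → j ≢ k → ∀ b → A j ≡ b → ⟦ b ⟧ ≤ 0
    off j j≢i j≢k true  eq = ⊥-elim (none (j , eq , j≢i , j≢k))
    off j j≢i j≢k false eq = z≤n

count≤1 : ∀ {A : Fin n → Bool} → (∀ i j → A i ≡ true → A j ≡ true → i ≡ j) → count A ≤ 1
count≤1 {A = A} uniq with 2 ≤? count A
... | no  ≱2 = ≤-pred (≰⇒> ≱2)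
... | yes ≥2 with count>0 (<⇒≤ ≥2)
...   | i , Ai with count-avoid₁ i ≥2
...     | j , Aj , j≢i = contradiction (uniq j i Aj Ai) j≢i

count≤1⇒unique : ∀ {A : Fin n → Bool} → count A ≤ 1 → ∀ {i j} → A i ≡ true → A j ≡ true → i ≡ j
count≤1⇒unique {n} {A = A} le {i} {j} Ai Aj with i ≟ j
... | yes i≡j = i≡j
... | no  i≢j = absurd (begin
  2                   ≡⟨ cong₂ _+_ (⟦⟧-true Ai) (⟦⟧-true Aj) ⟨
  ⟦ A i ⟧ + ⟦ A j ⟧   ≤⟨ m≤n+m _ (∑ {n} (λ _ → 0)) ⟩
  ∑ {n} (λ _ → 0) + (⟦ A i ⟧ + ⟦ A j ⟧)  ≤⟨ ∑-mono-except₂ {f = λ _ → 0} i≢j (λ _ _ _ → z≤n) ⟩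
  count A + 0         ≡⟨ +-identityʳ _ ⟩
  count A             ≤⟨ le ⟩
  1                   ∎)
  where open ≤-Reasoning

-- Each pair among `b`, `c`, `d` contains a true one, so at most one of the three is false.
two-of-three : ∀ {a b c d} → (a ≡ true → b ≡ true ⊎ c ≡ true) → (a ≡ true → b ≡ true ⊎ d ≡ true) →
               (a ≡ true → c ≡ true ⊎ d ≡ true) → 2 * ⟦ a ⟧ ≤ ⟦ b ⟧ + ⟦ c ⟧ + ⟦ d ⟧
two-of-three {false} p q r = z≤n
two-of-three {true} {b} {c} {d} p q r with p refl | q refl | r refl
... | inj₁ refl | _         | inj₁ refl = m≤m+n 2 ⟦ d ⟧
... | inj₁ refl | _         | inj₂ refl = ≤-trans (m≤n+m 2 ⟦ c ⟧) (≤-reflexive (solve-it ⟦ c ⟧))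
  where
  solve-it : ∀ x → x + 2 ≡ 1 + x + 1
  solve-it x = solve (x ∷ [])
... | inj₂ refl | inj₁ refl | _         = m≤m+n 2 ⟦ d ⟧
... | inj₂ refl | inj₂ refl | _         = ≤-trans (m≤n+m 2 ⟦ b ⟧) (≤-reflexive (solve-it ⟦ b ⟧))
  where
  solve-it : ∀ x → x + 2 ≡ x + 1 + 1
  solve-it x = solve (x ∷ [])

-- Diamond-free oriented graphs

module NoDiamond {n} (G : Digraph n)
  (no-loop : ∀ {v} → ¬ G v v ≡ true)
  (no-2-cycle : ∀ {u v} → G u v ≡ true → ¬ G v u ≡ true)
  (mid-unique : ∀ {x y₁ y₂ z} → G x y₁ ≡ true → G y₁ z ≡ true → G x y₂ ≡ true → G y₂ z ≡ true → y₁ ≡ y₂)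
  where

  indeg : Fin n → ℕ
  indeg v = count λ u → G u v

  arcs : ℕ
  arcs = ∑ indeg

  -- If S ⊆ N⁻(z) for some z, the 2-path from v to z witnessing hits S v is unique.
  hits : (Fin n → Bool) → Fin n → Bool
  hits S v = isYes (any? λ x → (S x ∧ G v x) Bool.≟ true)

  abstract
    hits-intro : ∀ {S v x} → S x ≡ true → G v x ≡ true → hits S v ≡ true
    hits-intro {S} {v} {x} Sx vx with any? (λ x → (S x ∧ G v x) Bool.≟ true)
    ... | yes _   = refl
    ... | no none = contradiction (x , ∧-intro Sx vx) none

    hits-elim : ∀ {S v} → hits S v ≡ true → ∃[ x ] S x ≡ true × G v x ≡ true
    hits-elim {S} {v} h with any? (λ x → (S x ∧ G v x) Bool.≟ true)
    ... | yes (x , p) = x , ∧-elim p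

  -- Double counting of the arcs into `S`: a tail contributes at most one, since its out-neighbours
  -- in `S` all precede `z` and `mid-unique` identifies them.
  hits-count : ∀ {S} z → (∀ {x} → S x ≡ true → G x z ≡ true) →
               ∑ (λ x → ⟦ S x ⟧ * indeg x) ≡ count (hits S)
  hits-count {S} z S⊆N⁻z = begin
    ∑ (λ x → ⟦ S x ⟧ * indeg x)               ≡⟨ sum-cong-≗ (λ x → *-distribˡ-sum ⟦ S x ⟧ (λ v → ⟦ G v x ⟧)) ⟩
    ∑ (λ x → ∑ λ v → ⟦ S x ⟧ * ⟦ G v x ⟧)     ≡⟨ ∑-comm (λ x v → ⟦ S x ⟧ * ⟦ G v x ⟧) ⟩
    ∑ (λ v → ∑ λ x → ⟦ S x ⟧ * ⟦ G v x ⟧)     ≡⟨ sum-cong-≗ (λ v → sum-cong-≗ λ x → ⟦∧⟧ (S x) (G v x)) ⟨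
    ∑ (λ v → count λ x → S x ∧ G v x)         ≡⟨ sum-cong-≗ pointwise ⟩
    count (hits S)                            ∎
    where
    open ≡-Reasoning
    pointwise : ∀ v → count (λ x → S x ∧ G v x) ≡ ⟦ hits S v ⟧
    pointwise v with true-or-false (hits S v)
    ... | inj₂ h rewrite h = trans (sum-cong-≗ λ x → none x (true-or-false (S x ∧ G v x))) (∑-zero n)
      where
      none : ∀ x → (S x ∧ G v x ≡ true) ⊎ (S x ∧ G v x ≡ false) → ⟦ S x ∧ G v x ⟧ ≡ 0
      none x (inj₁ t) = true≢false (hits-intro (proj₁ (∧-elim t)) (proj₂ (∧-elim t))) h
      none x (inj₂ f) rewrite f = refl
    ... | inj₁ h with hits-elim {S} h
    ...   | x₀ , Sx₀ , vx₀ rewrite h = ≤-antisym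
      (count≤1 λ i j p q → let Si , vi = ∧-elim p ; Sj , vj = ∧-elim q in
        mid-unique vi (S⊆N⁻z Si) vj (S⊆N⁻z Sj))
      (subst (_≤ count (λ x → S x ∧ G v x)) (⟦⟧-true (∧-intro Sx₀ vx₀)) (term≤∑ x₀ _))

  -- Arc count around a vertex of maximal indegree

  module MaxIndegree (y : Fin n) (maximal : ∀ v → indeg v ≤ indeg y) where

    X W P : Fin n → Bool
    X v = G v y
    W v = not (X v)
    P = hits X

    D b : ℕ
    D = indeg y
    b = count W

    D+b≡n : D + b ≡ n
    D+b≡n = count-not X

    def : Fin n → ℕ
    def v = D ∸ indeg v

    indeg+def : ∀ v → indeg v + def v ≡ D
    indeg+def v = m+[n∸m]≡n (maximal v)

    d : ℕ
    d = ∑ λ w → ⟦ W w ⟧ * def w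

    Miss Q : Fin n → Fin n → Bool
    Miss w x = X x ∧ not (G x w)
    Q w u = G u w ∧ W u

    miss q : Fin n → ℕ
    miss w = count (Miss w)
    q w = count (Q w)

    -- As `X` has `D` elements, `w` receives `D − miss w` arcs from `X` and `q w` from `W`. Each
    -- missing arc from `X` is thus either deficiency or compensated from `W`.
    miss≡def+q : ∀ w → miss w ≡ def w + q w
    miss≡def+q w = arith (count-split (λ u → G u w) X)
      (trans (cong (_+ miss w) (sum-cong-≗ λ u → cong ⟦_⟧ (Bool.∧-comm (G u w) (X u)))) (count-split X (λ u → G u w)))
      (indeg+def w)
      where
      arith : ∀ {c q m i e D} → c + q ≡ i → c + m ≡ D → i + e ≡ D → m ≡ e + q
      arith {c} {q} {m} {e = e} refl c+m≡D i+e≡D = +-cancelˡ-≡ c m (e + q) (begin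
        c + m        ≡⟨ c+m≡D ⟩
        _            ≡⟨ i+e≡D ⟨
        c + q + e    ≡⟨ solve (c ∷ q ∷ e ∷ []) ⟩
        c + (e + q)  ∎)
        where open ≡-Reasoning

    -- Arcs with head in `X` are counted by `hits-count` with `z = y`; those with head in `W` fall
    -- short of `D` per head by `d` in total.
    arcs+d : arcs + d ≡ D * b + count P
    arcs+d = begin
      ∑ indeg + d
        ≡⟨ cong (_+ d) (sum-cong-≗ λ v → split (X v) (indeg v)) ⟩
      ∑ (λ v → ⟦ X v ⟧ * indeg v + ⟦ W v ⟧ * indeg v) + d
        ≡⟨ cong (_+ d) (∑-distrib-+ (λ v → ⟦ X v ⟧ * indeg v) _) ⟩
      ∑ (λ v → ⟦ X v ⟧ * indeg v) + ∑ (λ v → ⟦ W v ⟧ * indeg v) + d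
        ≡⟨ +-assoc (∑ (λ v → ⟦ X v ⟧ * indeg v)) _ _ ⟩
      ∑ (λ v → ⟦ X v ⟧ * indeg v) + (∑ (λ v → ⟦ W v ⟧ * indeg v) + d)
        ≡⟨ cong₂ _+_ (hits-count y (λ Xx → Xx)) into-W ⟩
      count P + D * b
        ≡⟨ +-comm (count P) _ ⟩
      D * b + count P ∎
      where
      open ≡-Reasoning
      split : ∀ c k → k ≡ ⟦ c ⟧ * k + ⟦ not c ⟧ * k
      split true  k = solve (k ∷ [])
      split false k = solve (k ∷ [])
      into-W : ∑ (λ v → ⟦ W v ⟧ * indeg v) + d ≡ D * b
      into-W = begin
        ∑ (λ v → ⟦ W v ⟧ * indeg v) + d                    ≡⟨ ∑-distrib-+ (λ v → ⟦ W v ⟧ * indeg v) _ ⟨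
        ∑ (λ v → ⟦ W v ⟧ * indeg v + ⟦ W v ⟧ * def v)
          ≡⟨ sum-cong-≗ (λ v → trans (sym (*-distribˡ-+ ⟦ W v ⟧ (indeg v) (def v)))
               (cong (⟦ W v ⟧ *_) (indeg+def v))) ⟩
        ∑ (λ v → ⟦ W v ⟧ * D)                              ≡⟨ *-distribʳ-sum D (λ v → ⟦ W v ⟧) ⟨
        b * D                                              ≡⟨ *-comm b D ⟩
        D * b                                              ∎

    pX pW kX kW : ℕ
    pX = count λ v → P v ∧ X v
    pW = count λ v → P v ∧ W v
    kX = count λ v → X v ∧ not (P v)
    kW = count λ v → W v ∧ not (P v)

    pX+pW : pX + pW ≡ count P
    pX+pW = count-split P X

    pX+kX : pX + kX ≡ D
    pX+kX = trans (cong (_+ kX) (sum-cong-≗ λ v → cong ⟦_⟧ (Bool.∧-comm (P v) (X v)))) (count-split X P)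

    pW+kW : pW + kW ≡ b
    pW+kW = trans (cong (_+ kW) (sum-cong-≗ λ v → cong ⟦_⟧ (Bool.∧-comm (P v) (W v)))) (count-split W P)

    W-y : W y ≡ true
    W-y with X y in Xy
    ... | true  = contradiction Xy no-loop
    ... | false = refl

    ¬P-y : P y ≡ false
    ¬P-y with true-or-false (P y)
    ... | inj₂ f = f
    ... | inj₁ t with hits-elim {X} t
    ...   | x , Xx , yx = contradiction Xx (no-2-cycle yx)

    -- The witness is `y`: an arc from `y` into its own in-neighbourhood would close a 2-cycle. This
    -- unit is the second one in `d+2≤pX`.
    kW≥1 : 1 ≤ kW
    kW≥1 = subst (_≤ kW) (⟦⟧-true (∧-intro W-y (not-intro ¬P-y))) (term≤∑ y _)

    X-W : ∀ {x u} → X x ≡ true → W u ≡ true → x ≢ u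
    X-W Xx Wu refl = true≢false Xx (not-elim Wu)

    out-X-unique : ∀ {v x x′} → G v x ≡ true → X x ≡ true → G v x′ ≡ true → X x′ ≡ true → x ≡ x′
    out-X-unique = mid-unique

    -- Otherwise v → x → w and v → u → w would form a diamond.
    detour : ∀ {v u w x} → G v u ≡ true → Q w u ≡ true → G v x ≡ true → X x ≡ true → Miss w x ≡ true
    detour {w = w} {x} vu Qu vx Xx with true-or-false (G x w)
    ... | inj₂ f = ∧-intro Xx (not-intro f)
    ... | inj₁ t = let uw , Wu = ∧-elim Qu in
      contradiction (mid-unique vx t vu uw) (X-W Xx Wu)

    d-member : ∀ {w} → W w ≡ true → def w ≡ ⟦ W w ⟧ * def w
    d-member Ww rewrite Ww = sym (+-identityʳ _)

    -- Vertices of full indegree in `W`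

    isZero : ℕ → Bool
    isZero zero    = true
    isZero (suc _) = false

    -- The vertices of W with full indegree and an out-neighbour in X.
    W₁ : Fin n → Bool
    W₁ w = (P w ∧ W w) ∧ isZero (def w)

    -- The arc `f → w` would close a 2-cycle, so `w` misses `f`; having no deficiency, it must have
    -- an in-neighbour `u` in `W`.
    record Full (w : Fin n) : Set where
      field
        in-W  : W w ≡ true
        def≡0 : def w ≡ 0
        f     : Fin n
        w→f   : G w f ≡ true
        f∈X   : X f ≡ true

      miss≡q : miss w ≡ q w
      miss≡q = trans (miss≡def+q w) (cong (_+ q w) def≡0)

      f-missed : Miss w f ≡ true
      f-missed with true-or-false (G f w)
      ... | inj₁ t = contradiction t (no-2-cycle w→f)
      ... | inj₂ h = ∧-intro f∈X (not-intro h)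

      q≥1 : 1 ≤ q w
      q≥1 = subst₂ _≤_ (⟦⟧-true f-missed) miss≡q (term≤∑ f _)

      abstract
        u : Fin n
        u = proj₁ (count>0 {A = Q w} q≥1)

        u∈Q : Q w u ≡ true
        u∈Q = proj₂ (count>0 {A = Q w} q≥1)

      u∈W : W u ≡ true
      u∈W = proj₂ (∧-elim u∈Q)

    full : ∀ {w} → W₁ w ≡ true → Full w
    full {w} h = let PW , z = ∧-elim h ; Pw , Ww = ∧-elim PW ; x , Xx , wx = hits-elim {X} Pw in
      record { in-W = Ww ; def≡0 = zero-elim (def w) z ; f = x ; w→f = wx ; f∈X = Xx }
      where
      zero-elim : ∀ k → isZero k ≡ true → k ≡ 0
      zero-elim zero _ = refl

    W₁-dominates : ∀ w → ⟦ P w ∧ W w ⟧ ≤ ⟦ W₁ w ⟧ + ⟦ W w ⟧ * def w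
    W₁-dominates w with P w | W w | def w
    ... | false | _     | _     = z≤n
    ... | true  | false | _     = z≤n
    ... | true  | true  | zero  = s≤s z≤n
    ... | true  | true  | suc k = s≤s z≤n

    ∑-W₁+d : ∑ (λ w → ⟦ W₁ w ⟧ + ⟦ W w ⟧ * def w) ≡ count W₁ + d
    ∑-W₁+d = ∑-distrib-+ (λ w → ⟦ W₁ w ⟧) _

    pW≤W₁+d : pW ≤ count W₁ + d
    pW≤W₁+d = ≤-trans (∑-mono W₁-dominates) (≤-reflexive ∑-W₁+d)

    weight≥def : ∀ {w} → W w ≡ true → def w ≤ ⟦ W₁ w ⟧ + ⟦ W w ⟧ * def w
    weight≥def {w} Ww = ≤-trans (≤-reflexive (d-member Ww)) (m≤n+m _ ⟦ W₁ w ⟧)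

    -- `W₁-dominates` uses only one unit of a positive deficiency. Exempting `u` keeps all of
    -- `def u`, at the price of the one unit that `u` may contribute to `pW`.
    pW+def≤ : ∀ {u} → W u ≡ true → pW + def u ≤ count W₁ + d + 1
    pW+def≤ {u} Wu = begin
      pW + def u                                      ≤⟨ +-monoʳ-≤ pW (weight≥def Wu) ⟩
      pW + (⟦ W₁ u ⟧ + ⟦ W u ⟧ * def u)               ≤⟨ ∑-mono-except₁ u (λ w _ → W₁-dominates w) ⟩
      ∑ (λ w → ⟦ W₁ w ⟧ + ⟦ W w ⟧ * def w) + ⟦ P u ∧ W u ⟧  ≤⟨ +-mono-≤ (≤-reflexive ∑-W₁+d) (⟦⟧≤1 (P u ∧ W u)) ⟩
      count W₁ + d + 1                                ∎
      where open ≤-Reasoning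

    pW+def+def≤ : ∀ {u v} → u ≢ v → W u ≡ true → W v ≡ true → pW + (def u + def v) ≤ count W₁ + d + 2
    pW+def+def≤ {u} {v} u≢v Wu Wv = begin
      pW + (def u + def v)
        ≤⟨ +-monoʳ-≤ pW (+-mono-≤ (weight≥def Wu) (weight≥def Wv)) ⟩
      pW + ((⟦ W₁ u ⟧ + ⟦ W u ⟧ * def u) + (⟦ W₁ v ⟧ + ⟦ W v ⟧ * def v))
        ≤⟨ ∑-mono-except₂ u≢v (λ w _ _ → W₁-dominates w) ⟩
      ∑ (λ w → ⟦ W₁ w ⟧ + ⟦ W w ⟧ * def w) + (⟦ P u ∧ W u ⟧ + ⟦ P v ∧ W v ⟧)
        ≤⟨ +-mono-≤ (≤-reflexive ∑-W₁+d) (+-mono-≤ (⟦⟧≤1 (P u ∧ W u)) (⟦⟧≤1 (P v ∧ W v))) ⟩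
      count W₁ + d + 2 ∎
      where open ≤-Reasoning

    M : Fin n → ℕ
    M w = count (hits (Q w))

    -- Count the 2-paths `v → u → w` with `u ∈ W`: each `u` has `D − def u` in-neighbours, no `v`
    -- serves two different `u`, and the deficiencies sum to at most `d`.
    q*D≤M+d : ∀ w → q w * D ≤ M w + d
    q*D≤M+d w = begin
      q w * D                                               ≡⟨ *-distribʳ-sum D (λ u → ⟦ Q w u ⟧) ⟩
      ∑ (λ u → ⟦ Q w u ⟧ * D)                               ≤⟨ ∑-mono₁₂ pointwise ⟩
      ∑ (λ u → ⟦ Q w u ⟧ * indeg u) + d                     ≡⟨ cong (_+ d) (hits-count w (proj₁ ∘ ∧-elim)) ⟩
      M w + d                                               ∎
      where
      open ≤-Reasoning
      pointwise : ∀ u → ⟦ Q w u ⟧ * D ≤ ⟦ Q w u ⟧ * indeg u + ⟦ W u ⟧ * def u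
      pointwise u = begin
        ⟦ Q w u ⟧ * D                               ≡⟨ cong (⟦ Q w u ⟧ *_) (indeg+def u) ⟨
        ⟦ Q w u ⟧ * (indeg u + def u)               ≡⟨ *-distribˡ-+ ⟦ Q w u ⟧ _ _ ⟩
        ⟦ Q w u ⟧ * indeg u + ⟦ Q w u ⟧ * def u
          ≤⟨ +-monoʳ-≤ (⟦ Q w u ⟧ * indeg u) (*-monoˡ-≤ (def u) (⟦⟧-mono {Q w u} {W u} (proj₂ ∘ ∧-elim {G u w}))) ⟩
        ⟦ Q w u ⟧ * indeg u + ⟦ W u ⟧ * def u       ∎

    miss-either : ∀ {x v w} → X x ≡ true → (G x v ≡ true → ¬ G x w ≡ true) →
                  Miss v x ≡ true ⊎ Miss w x ≡ true
    miss-either {x} {v} {w} Xx notBoth with true-or-false (G x v)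
    ... | inj₂ h = inj₁ (∧-intro Xx (not-intro h))
    ... | inj₁ h with true-or-false (G x w)
    ...   | inj₂ h′ = inj₂ (∧-intro Xx (not-intro h′))
    ...   | inj₁ h′ = contradiction h′ (notBoth h)

    count≤n : ∀ A → count {n} A ≤ n
    count≤n A = ≤-trans (∑-mono λ i → ⟦⟧≤1 (A i)) (≤-reflexive (trans (∑-const n 1) (*-identityʳ n)))

    -- Consequences of too many arcs

    -- The first two premises compare `arcs` with `(D + 1) * b` and `D * (b + 1)`, whose factors sum
    -- to `n + 1`. The constants 32 and 12 are used up exactly in `SomeQ≥2.q≤1` and
    -- `SomeQ≥2.not-three`.
    module Dense (arcs>ab+b : D * b + b < arcs) (arcs>ab+a : D * b + D < arcs)
                 (b≤2D+1 : b ≤ 2 * D + 1) (D+32≤2b : D + 32 ≤ 2 * b) (12≤D : 12 ≤ D) where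

      P-large : b + 1 + d ≤ count P
      P-large = arith arcs>ab+b arcs+d
        where
        arith : ∀ {ab b e d p} → ab + b < e → e + d ≡ ab + p → b + 1 + d ≤ p
        arith {ab} {b} {e} {d} {p} lt eq = +-cancelˡ-≤ ab _ _ (subst (ab + (b + 1 + d) ≤_) eq
          (linear 0 lt (solve (ab ∷ b ∷ e ∷ d ∷ []))))

      pX-large : kW + 1 + d ≤ pX
      pX-large = arith pW+kW pX+pW P-large
        where
        arith : ∀ {pw kw b px p d} → pw + kw ≡ b → px + pw ≡ p → b + 1 + d ≤ p → kw + 1 + d ≤ px
        arith {pw} {kw} {px = px} {d = d} refl refl h = linear 0 h (solve (pw ∷ kw ∷ px ∷ d ∷ []))

      pW-large : kX + 1 + d ≤ pW
      pW-large = arith pX+kX pX+pW arcs>ab+a arcs+d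
        where
        arith : ∀ {px kx D pw p ab e d} → px + kx ≡ D → px + pw ≡ p → ab + D < e → e + d ≡ ab + p → kx + 1 + d ≤ pw
        arith {px} {kx} {pw = pw} {ab = ab} {e} {d} refl refl lt eq =
          linear 0 (+-mono-≤ lt (≤-reflexive eq)) (solve (px ∷ kx ∷ pw ∷ ab ∷ e ∷ d ∷ []))

      d+2≤pX : d + 2 ≤ pX
      d+2≤pX = arith kW≥1 pX-large
        where
        arith : ∀ {k d p} → 1 ≤ k → k + 1 + d ≤ p → d + 2 ≤ p
        arith {k} {d} {p} h g = linear 0 (+-mono-≤ h g) (solve (k ∷ d ∷ p ∷ []))

      pX≤D : pX ≤ D
      pX≤D = subst (pX ≤_) pX+kX (m≤m+n pX kX)

      -- `q w * D ≤ M w + d`, where `M w ≤ D + b ≤ 3 * D + 1` and `d ≤ D − 2`; the total is below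
      -- `4 * D`.
      q≤3 : ∀ w → q w ≤ 3
      q≤3 w = ≤-pred (*-cancelʳ-< D (q w) 4 (arith (q*D≤M+d w) (count≤n _) D+b≡n b≤2D+1 (≤-trans d+2≤pX pX≤D)))
        where
        arith : ∀ {x m d n D b} → x ≤ m + d → m ≤ n → D + b ≡ n → b ≤ 2 * D + 1 → d + 2 ≤ D → x < 4 * D
        arith {x} {m} {d} {D = D} {b} h₁ h₂ refl h₃ h₄ =
          linear 0 (+-mono-≤ (+-mono-≤ h₁ h₂) (+-mono-≤ h₃ h₄)) (solve (x ∷ m ∷ d ∷ D ∷ b ∷ []))

      open Full

      -- If `w₁` and `w₂` shared `f`, an `x` preceding both would give a diamond from `x` to `f`. So
      -- every element of `X` would be missed by one of them, and they miss at most 3 each.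
      f-injective : ∀ {w₁ w₂} (F₁ : Full w₁) (F₂ : Full w₂) → f F₁ ≡ f F₂ → w₁ ≡ w₂
      f-injective {w₁} {w₂} F₁ F₂ same with w₁ ≟ w₂
      ... | yes eq = eq
      ... | no w₁≢w₂ = absurd (≤-trans (≤-trans (m≤m+n 7 5) 12≤D) (begin
          D                    ≤⟨ ∑-mono₁₂ (λ x → ⟦⟧-≤-+ λ Xx → miss-either {x} Xx λ h h′ →
            w₁≢w₂ (mid-unique h (w→f F₁) h′ (subst (λ c → G w₂ c ≡ true) (sym same) (w→f F₂)))) ⟩
          miss w₁ + miss w₂    ≡⟨ cong₂ _+_ (miss≡q F₁) (miss≡q F₂) ⟩
          q w₁ + q w₂          ≤⟨ +-mono-≤ (q≤3 w₁) (q≤3 w₂) ⟩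
          6                    ∎))
        where
        open ≤-Reasoning

      missed-only-f : ∀ {w} (F : Full w) → q w ≤ 1 → ∀ {x} → Miss w x ≡ true → x ≡ f F
      missed-only-f {w} F q≤1 h = count≤1⇒unique {A = Miss w} (≤-trans (≤-reflexive (miss≡q F)) q≤1) h (f-missed F)

      -- `detour` makes `x` a vertex missed by `w`, and with `q w ≤ 1` only `f F` is missed.
      out-of-u : ∀ {w} (F : Full w) → q w ≤ 1 → ∀ {v x} → G v (u F) ≡ true → G v x ≡ true → X x ≡ true → x ≡ f F
      out-of-u {w} F q≤1 vu vx Xx = missed-only-f F q≤1 (detour vu (u∈Q F) vx Xx)

      -- Pairs and triples of full vertices

      module Pair {w₁ w₂} (F₁ : Full w₁) (F₂ : Full w₂) (w₁≢w₂ : w₁ ≢ w₂) (q₁ : q w₁ ≤ 1) (q₂ : q w₂ ≤ 1) where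

        common-in-nbr : ∀ {v} → G v (u F₁) ≡ true → G v (u F₂) ≡ true → ¬ P v ≡ true
        common-in-nbr vu₁ vu₂ Pv with hits-elim {X} Pv
        ... | x , Xx , vx = w₁≢w₂ (f-injective F₁ F₂
          (trans (sym (out-of-u F₁ q₁ vu₁ vx Xx)) (out-of-u F₂ q₂ vu₂ vx Xx)))

        -- For a common `u`, the in-neighbourhood of `u` would avoid `P`, so
        -- `indeg u + count P ≤ n`. But `count P ≥ b + 1 + def u` makes this sum at least `n + 1`.
        u-distinct : u F₁ ≢ u F₂
        u-distinct same = arith disjoint (indeg+def (u F₁)) P-large
          (≤-trans (≤-reflexive (d-member (u∈W F₁))) (term≤∑ (u F₁) _)) D+b≡n
          where
          pointwise : ∀ v → ⟦ G v (u F₁) ⟧ + ⟦ P v ⟧ ≤ 1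
          pointwise v = ⟦⟧-disjoint λ h → common-in-nbr h (subst (λ z → G v z ≡ true) same h)
          disjoint : indeg (u F₁) + count P ≤ n
          disjoint = begin
            indeg (u F₁) + count P                 ≡⟨ ∑-distrib-+ (λ v → ⟦ G v (u F₁) ⟧) _ ⟨
            ∑ (λ v → ⟦ G v (u F₁) ⟧ + ⟦ P v ⟧)     ≤⟨ ∑-mono pointwise ⟩
            ∑ {n} (λ _ → 1)                        ≡⟨ trans (∑-const n 1) (*-identityʳ n) ⟩
            n                                      ∎
            where open ≤-Reasoning
          arith : ∀ {i p n e D b d} → i + p ≤ n → i + e ≡ D → b + 1 + d ≤ p → e ≤ d → D + b ≡ n → ⊥
          arith {i} {p} {e = e} {b = b} {d} h₁ refl h₂ h₃ refl with
            linear {x = 1} {y = 0} 0 (+-mono-≤ h₁ (+-mono-≤ h₂ h₃)) (solve (i ∷ p ∷ e ∷ b ∷ d ∷ []))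
          ... | ()

        cover : ∀ x → P x ∧ X x ≡ true → Miss (u F₁) x ≡ true ⊎ Miss (u F₂) x ≡ true
        cover x PX = let Px , Xx = ∧-elim {P x} PX in
          miss-either Xx λ h h′ → common-in-nbr h h′ Px

        pX≤miss+miss : pX ≤ miss (u F₁) + miss (u F₂)
        pX≤miss+miss = ∑-mono₁₂ λ x → ⟦⟧-≤-+ (cover x)

      -- By `cover` for each pair, at least two of the three `u` miss any given vertex of `P ∩ X`.
      -- The three `u` are distinct members of `W`, so their deficiencies sum to at most `d`.
      triple : ∀ {w₁ w₂ w₃} (F₁ : Full w₁) (F₂ : Full w₂) (F₃ : Full w₃) → w₁ ≢ w₂ → w₁ ≢ w₃ → w₂ ≢ w₃ →
               q w₁ ≤ 1 → q w₂ ≤ 1 → q w₃ ≤ 1 → 2 * pX ≤ d + (q (u F₁) + q (u F₂) + q (u F₃))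
      triple F₁ F₂ F₃ ≢₁₂ ≢₁₃ ≢₂₃ q₁ q₂ q₃ =
        arith {e₁ = def (u F₁)} {def (u F₂)} {def (u F₃)} {q (u F₁)} {q (u F₂)} {q (u F₃)}
          double (miss≡def+q (u F₁)) (miss≡def+q (u F₂)) (miss≡def+q (u F₃)) defs
        where
        module P₁₂ = Pair F₁ F₂ ≢₁₂ q₁ q₂
        module P₁₃ = Pair F₁ F₃ ≢₁₃ q₁ q₃
        module P₂₃ = Pair F₂ F₃ ≢₂₃ q₂ q₃
        double : 2 * pX ≤ miss (u F₁) + miss (u F₂) + miss (u F₃)
        double = ≤-trans (≤-reflexive (*-distribˡ-sum 2 (λ x → ⟦ P x ∧ X x ⟧)))
          (∑-mono₁₃ λ x → two-of-three (P₁₂.cover x) (P₁₃.cover x) (P₂₃.cover x))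
        defs : def (u F₁) + def (u F₂) + def (u F₃) ≤ d
        defs = ≤-trans (≤-reflexive (cong₂ _+_ (cong₂ _+_ (d-member (u∈W F₁)) (d-member (u∈W F₂))) (d-member (u∈W F₃))))
          (∑-three (λ w → ⟦ W w ⟧ * def w) P₁₂.u-distinct P₁₃.u-distinct P₂₃.u-distinct)
        arith : ∀ {x e₁ e₂ e₃ q₁ q₂ q₃ m₁ m₂ m₃ d} → x ≤ m₁ + m₂ + m₃ → m₁ ≡ e₁ + q₁ → m₂ ≡ e₂ + q₂ → m₃ ≡ e₃ + q₃ →
                e₁ + e₂ + e₃ ≤ d → x ≤ d + (q₁ + q₂ + q₃)
        arith {x} {e₁} {e₂} {e₃} {q₁} {q₂} {q₃} {d = d} h refl refl refl g =
          linear 0 (+-mono-≤ h g) (solve (x ∷ e₁ ∷ e₂ ∷ e₃ ∷ q₁ ∷ q₂ ∷ q₃ ∷ d ∷ []))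

      abstract
        W₁-nonempty : 1 ≤ count W₁
        W₁-nonempty = arith pW-large pW≤W₁+d
          where
          arith : ∀ {k d p c} → k + 1 + d ≤ p → p ≤ c + d → 1 ≤ c
          arith {k} {d} {p} {c} h g = linear k (+-mono-≤ h g) (solve (k ∷ d ∷ p ∷ c ∷ []))

      -- Case: every vertex has at most one in-neighbour in `W`

      module AllQ≤1 (q≤1 : ∀ w → q w ≤ 1) where

        -- `pX ≤ def u₁ + def u₂ + 2` and `pW+def+def≤` give `b ≤ count W₁ + 3`, hence a third
        -- member of `W₁`. Then `triple` yields `2 * pX ≤ d + 3`, against `d + 2 ≤ pX`.
        not-two : ∀ {w₁ w₂} → W₁ w₁ ≡ true → W₁ w₂ ≡ true → ¬ w₁ ≢ w₂
        not-two {w₁} {w₂} h₁ h₂ w₁≢w₂ with count-avoid₂ {A = W₁} w₁≢w₂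
          (arith (Pair.pX≤miss+miss F₁ F₂ w₁≢w₂ (q≤1 w₁) (q≤1 w₂)) (miss≡def+q u₁) (miss≡def+q u₂) (q≤1 u₁) (q≤1 u₂)
            (pW+def+def≤ (Pair.u-distinct F₁ F₂ w₁≢w₂ (q≤1 w₁) (q≤1 w₂)) (u∈W F₁) (u∈W F₂)) pW+kW pX-large D+32≤2b 12≤D)
          where
          F₁ = full h₁
          F₂ = full h₂
          u₁ = u F₁
          u₂ = u F₂
          arith : ∀ {x m₁ m₂ e₁ e₂ q₁ q₂ pw kw c d b D} → x ≤ m₁ + m₂ → m₁ ≡ e₁ + q₁ → m₂ ≡ e₂ + q₂ → q₁ ≤ 1 → q₂ ≤ 1 →
                  pw + (e₁ + e₂) ≤ c + d + 2 → pw + kw ≡ b → kw + 1 + d ≤ x → D + 32 ≤ 2 * b → 12 ≤ D → 3 ≤ c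
          arith {x} {e₁ = e₁} {e₂} {q₁} {q₂} {pw} {kw} {c} {d} {D = D} h₁ refl refl h₂ h₃ h₄ refl h₅ h₆ h₇ =
            *-cancelˡ-≤ 2 (linear 32 (+-mono-≤ (scale 2 (+-mono-≤ (+-mono-≤ h₁ h₂) (+-mono-≤ h₃ (+-mono-≤ h₄ h₅)))) (+-mono-≤ h₆ h₇))
              (solve (x ∷ e₁ ∷ e₂ ∷ q₁ ∷ q₂ ∷ pw ∷ kw ∷ c ∷ d ∷ D ∷ [])))
        ... | w₃ , h₃ , w₃≢w₁ , w₃≢w₂ = n≮0 (arith
          (triple F₁ F₂ F₃ w₁≢w₂ (w₃≢w₁ ∘ sym) (w₃≢w₂ ∘ sym) (q≤1 w₁) (q≤1 w₂) (q≤1 w₃))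
          (q≤1 (u F₁)) (q≤1 (u F₂)) (q≤1 (u F₃)) d+2≤pX)
          where
          F₁ = full h₁
          F₂ = full h₂
          F₃ = full h₃
          arith : ∀ {x d q₁ q₂ q₃} → 2 * x ≤ d + (q₁ + q₂ + q₃) → q₁ ≤ 1 → q₂ ≤ 1 → q₃ ≤ 1 → d + 2 ≤ x → 1 ≤ 0
          arith {x} {d} {q₁} {q₂} {q₃} h h₁ h₂ h₃ g =
            linear d (+-mono-≤ (+-mono-≤ h h₁) (+-mono-≤ (+-mono-≤ h₂ h₃) (scale 2 g))) (solve (x ∷ d ∷ q₁ ∷ q₂ ∷ q₃ ∷ []))

        module Single {w} (F : Full w) (W₁≤1 : count W₁ ≤ 1) where

          -- Here `pW ≤ d + 1`, so `pW-large` forces `kX = 0`.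
          X⊆P : ∀ {x} → X x ≡ true → P x ≡ true
          X⊆P {x} Xx with true-or-false (P x)
          ... | inj₁ t = t
          ... | inj₂ ¬Px = ⊥-elim (n≮0 (arith W₁≤1 pW≤W₁+d pW-large
            (subst (_≤ kX) (⟦⟧-true (∧-intro Xx (not-intro ¬Px))) (term≤∑ x (λ v → ⟦ X v ∧ not (P v) ⟧)))))
            where
            arith : ∀ {c p d k} → c ≤ 1 → p ≤ c + d → k + 1 + d ≤ p → 1 ≤ k → 1 ≤ 0
            arith {c} {p} {d} {k} h₁ h₂ h₃ h₄ = linear 0 (+-mono-≤ (+-mono-≤ h₁ h₂) (+-mono-≤ h₃ h₄)) (solve (c ∷ p ∷ d ∷ k ∷ []))

          -- `pW ≥ d + 1` and `pW + def (u F) ≤ d + 2` leave a deficiency of at most 1, and `q` adds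
          -- at most 1.
          miss-u≤2 : miss (u F) ≤ 2
          miss-u≤2 = arith (pW+def≤ (u∈W F)) W₁≤1 pW-large (miss≡def+q (u F)) (q≤1 (u F))
            where
            arith : ∀ {p e c d k m q} → p + e ≤ c + d + 1 → c ≤ 1 → k + 1 + d ≤ p → m ≡ e + q → q ≤ 1 → m ≤ 2
            arith {p} {e} {c} {d} {k} {q = q} h₁ h₂ h₃ refl h₄ =
              linear k (+-mono-≤ (+-mono-≤ h₁ h₂) (+-mono-≤ h₃ h₄)) (solve (p ∷ e ∷ c ∷ d ∷ k ∷ q ∷ []))

          not-to-u : ∀ {x x′} → X x ≡ true → G x x′ ≡ true → X x′ ≡ true → x′ ≢ f F → Miss (u F) x ≡ true
          not-to-u {x} Xx xx′ Xx′ x′≢f with true-or-false (G x (u F))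
          ... | inj₂ h = ∧-intro Xx (not-intro h)
          ... | inj₁ h = contradiction (out-of-u F (q≤1 w) h xx′ Xx′) x′≢f

          -- The orbit c → c₁ → c₂ of f F inside X misses u three times.
          impossible : ⊥
          impossible with hits-elim {X} (X⊆P (f∈X F))
          ... | c₁ , X₁ , c→c₁ with hits-elim {X} (X⊆P X₁)
          ...   | c₂ , X₂ , c₁→c₂ with hits-elim {X} (X⊆P X₂)
          ...     | c₃ , X₃ , c₂→c₃ = n≮0 (≤-pred (≤-pred (≤-trans
            (subst (_≤ miss (u F)) (cong₂ _+_ (cong₂ _+_ (⟦⟧-true miss-c) (⟦⟧-true miss-c₁)) (⟦⟧-true miss-c₂))
              (∑-three (λ x → ⟦ Miss (u F) x ⟧) c≢c₁ c≢c₂ c₁≢c₂)) miss-u≤2)))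
            where
            c = f F
            c≢c₁ : c ≢ c₁
            c≢c₁ refl = no-loop c→c₁
            c₁≢c₂ : c₁ ≢ c₂
            c₁≢c₂ refl = no-loop c₁→c₂
            c≢c₂ : c ≢ c₂
            c≢c₂ refl = no-2-cycle c→c₁ c₁→c₂
            c₁→w : G c₁ w ≡ true
            c₁→w with true-or-false (G c₁ w)
            ... | inj₁ t = t
            ... | inj₂ h = contradiction (sym (missed-only-f F (q≤1 w) (∧-intro X₁ (not-intro h)))) c≢c₁
            -- If `c₃ = c`, the 2-paths `c₁ → c₂ → c` and `c₁ → w → c` form a diamond, since
            -- `c₂ ∈ X` and `w ∈ W`.
            c₃≢c : c₃ ≢ c
            c₃≢c refl = X-W X₂ (in-W F) (mid-unique c₁→c₂ c₂→c₃ c₁→w (w→f F))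
            miss-c : Miss (u F) c ≡ true
            miss-c = not-to-u (f∈X F) c→c₁ X₁ (c≢c₁ ∘ sym)
            miss-c₁ : Miss (u F) c₁ ≡ true
            miss-c₁ = not-to-u X₁ c₁→c₂ X₂ (c≢c₂ ∘ sym)
            miss-c₂ : Miss (u F) c₂ ≡ true
            miss-c₂ = not-to-u X₂ c₂→c₃ X₃ c₃≢c

        impossible : ⊥
        impossible with count>0 {A = W₁} W₁-nonempty | 2 ≤? count W₁
        ... | w , h | no ≱2 = Single.impossible (full h) (≤-pred (≰⇒> ≱2))
        ... | w , h | yes ≥2 with count-avoid₁ {A = W₁} w ≥2
        ...   | w′ , h′ , w′≢w = not-two h′ h w′≢w

      -- Non-arcs forced by detours, and indegrees in `X`

      module Detours {w} (F : Full w) where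

        H : Fin n → Bool
        H = hits (Q w)

        -- R x counts the v with v → x that also reach w by a 2-path through W.
        R : Fin n → ℕ
        R x = count λ v → H v ∧ G v x

        S : ℕ
        S = ∑ λ x → ⟦ Miss w x ⟧ * R x

        R≤indeg : ∀ x → R x ≤ indeg x
        R≤indeg x = ∑-mono λ v → ⟦⟧-mono (proj₂ ∘ ∧-elim {H v} {G v x})

        -- Inclusion-exclusion: a `v` in both `H` and `P` has an out-neighbour in `X`, which `w`
        -- misses by `detour`, so `v` is counted in `S`.
        M+P≤n+S : M w + count P ≤ n + S
        M+P≤n+S = begin
          M w + count P
            ≡⟨ ∑-distrib-+ (λ v → ⟦ H v ⟧) _ ⟨
          ∑ (λ v → ⟦ H v ⟧ + ⟦ P v ⟧)
            ≤⟨ ∑-mono₁₂ {g = λ _ → 1} (λ v → pointwise v (H v) (P v) refl refl) ⟩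
          ∑ {n} (λ _ → 1) + ∑ (λ v → ∑ λ x → ⟦ Miss w x ⟧ * ⟦ H v ∧ G v x ⟧)
            ≡⟨ cong₂ _+_ (trans (∑-const n 1) (*-identityʳ n)) (∑-comm (λ v x → ⟦ Miss w x ⟧ * ⟦ H v ∧ G v x ⟧)) ⟩
          n + ∑ (λ x → ∑ λ v → ⟦ Miss w x ⟧ * ⟦ H v ∧ G v x ⟧)
            ≡⟨ cong (n +_) (sum-cong-≗ λ x → *-distribˡ-sum ⟦ Miss w x ⟧ (λ v → ⟦ H v ∧ G v x ⟧)) ⟨
          n + S ∎
          where
          open ≤-Reasoning
          pointwise : ∀ v h p → H v ≡ h → P v ≡ p → ⟦ h ⟧ + ⟦ p ⟧ ≤ 1 + ∑ λ x → ⟦ Miss w x ⟧ * ⟦ H v ∧ G v x ⟧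
          pointwise v false p     _  _  = ≤-trans (⟦⟧≤1 p) (m≤m+n 1 _)
          pointwise v true  false _  _  = m≤m+n 1 _
          pointwise v true  true  Hv Pv with hits-elim {Q w} Hv | hits-elim {X} Pv
          ... | u , Qu , vu | x , Xx , vx = s≤s (subst (_≤ ∑ λ x → ⟦ Miss w x ⟧ * ⟦ H v ∧ G v x ⟧)
            (cong₂ _*_ (⟦⟧-true (detour vu Qu vx Xx)) (⟦⟧-true (∧-intro Hv vx)))
            (term≤∑ x (λ x → ⟦ Miss w x ⟧ * ⟦ H v ∧ G v x ⟧)))

        q*D<D+S : q w * D < D + S
        q*D<D+S = arith (q*D≤M+d w) M+P≤n+S P-large D+b≡n
          where
          arith : ∀ {x m d p n s b D} → x ≤ m + d → m + p ≤ n + s → b + 1 + d ≤ p → D + b ≡ n → x < D + s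
          arith {x} {m} {d} {p} {s = s} {b} {D} h₁ h₂ h₃ refl =
            linear 0 (+-mono-≤ h₁ (+-mono-≤ h₂ h₃)) (solve (x ∷ m ∷ d ∷ p ∷ s ∷ b ∷ D ∷ []))

        miss*D : ∑ (λ x → ⟦ Miss w x ⟧ * D) ≡ q w * D
        miss*D = trans (sym (*-distribʳ-sum D (λ x → ⟦ Miss w x ⟧))) (cong (_* D) (miss≡q F))

        -- Bounding every term of `S` except that of `f F` by `D`, `q*D<D+S` forces `R (f F) ≥ 1`. A
        -- further in-neighbour is `w`, which lies outside `H` because `w → v → w` is a 2-cycle.
        2≤indeg-f : 2 ≤ indeg (f F)
        2≤indeg-f = arith {D = D} {S} q*D<D+S S+D≤ R+1≤indeg
          where
          c = f F
          one-times : ∀ k → ⟦ Miss w c ⟧ * k ≡ k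
          one-times k = trans (cong (_* k) (⟦⟧-true (f-missed F))) (*-identityˡ k)
          S+D≤ : S + D ≤ q w * D + R c
          S+D≤ = subst₂ _≤_ (cong (S +_) (one-times D)) (cong₂ _+_ miss*D (one-times (R c)))
            (∑-mono-except₁ c {λ x → ⟦ Miss w x ⟧ * R x} {λ x → ⟦ Miss w x ⟧ * D}
              λ x _ → *-monoʳ-≤ ⟦ Miss w x ⟧ (≤-trans (R≤indeg x) (maximal x)))
          w∉H : H w ≡ false
          w∉H with true-or-false (H w)
          ... | inj₂ h = h
          ... | inj₁ h with hits-elim {Q w} h
          ...   | v , Qv , wv = contradiction (proj₁ (∧-elim Qv)) (no-2-cycle wv)
          R+1≤indeg : R c + 1 ≤ indeg c
          R+1≤indeg = subst₂ _≤_ (cong (R c +_) (⟦⟧-true (w→f F)))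
            (trans (cong (λ h → indeg c + ⟦ h ∧ G w c ⟧) w∉H) (+-identityʳ (indeg c)))
            (∑-mono-except₁ w {λ v → ⟦ H v ∧ G v c ⟧} {λ v → ⟦ G v c ⟧}
              λ v _ → ⟦⟧-mono (proj₂ ∘ ∧-elim {H v} {G v c}))
          arith : ∀ {x D s r i} → x < D + s → s + D ≤ x + r → r + 1 ≤ i → 2 ≤ i
          arith {x} {D} {s} {r} {i} h₁ h₂ h₃ = linear 0 (+-mono-≤ h₁ (+-mono-≤ h₂ h₃)) (solve (x ∷ D ∷ s ∷ r ∷ i ∷ []))

        -- If all indegrees in `X` were at most `D / 2`, then `2 * S ≤ q w * D`, and `q*D<D+S` would
        -- give `q w < 2`.
        popular : 2 ≤ q w → ∃[ x ] X x ≡ true × D < 2 * indeg x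
        popular 2≤q with any? (λ x → (X x Bool.≟ true) ×-dec (suc D ≤? 2 * indeg x))
        ... | yes found = found
        ... | no none = ⊥-elim (n≮0 (arith {D = D} {S} q*D<D+S 2S≤q*D (*-monoˡ-≤ D 2≤q)))
          where
          pointwise : ∀ x → 2 * (⟦ Miss w x ⟧ * R x) ≤ ⟦ Miss w x ⟧ * D
          pointwise x with true-or-false (Miss w x)
          ... | inj₂ h rewrite h = z≤n
          ... | inj₁ h rewrite h = ≤-trans (≤-reflexive (cong (2 *_) (*-identityˡ (R x)))) (≤-trans (*-monoʳ-≤ 2 (R≤indeg x))
            (≤-trans (≮⇒≥ λ lt → none (x , proj₁ (∧-elim h) , lt)) (≤-reflexive (sym (*-identityˡ D)))))
          2S≤q*D : 2 * S ≤ q w * D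
          2S≤q*D = begin
            2 * S                                     ≡⟨ *-distribˡ-sum 2 (λ x → ⟦ Miss w x ⟧ * R x) ⟩
            ∑ (λ x → 2 * (⟦ Miss w x ⟧ * R x))        ≤⟨ ∑-mono pointwise ⟩
            ∑ (λ x → ⟦ Miss w x ⟧ * D)                ≡⟨ miss*D ⟩
            q w * D                                   ∎
            where open ≤-Reasoning
          arith : ∀ {x D s} → x < D + s → 2 * s ≤ x → 2 * D ≤ x → 1 ≤ 0
          arith {x} {D} {s} h₁ h₂ h₃ = linear 1 (+-mono-≤ (scale 2 h₁) (+-mono-≤ h₂ h₃)) (solve (x ∷ D ∷ s ∷ []))

      -- The indegrees over `X` sum to `count P ≤ n`. Members of `W₁` have distinct out-neighbours
      -- `f` in `X`, each of indegree at least 2. The 2 on the right allows for `x` being one of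
      -- them.
      2W₁+indeg≤n+2 : ∀ {x} → X x ≡ true → 2 * count W₁ + indeg x ≤ n + 2
      2W₁+indeg≤n+2 {x} Xx = begin
        2 * count W₁ + indeg x
          ≤⟨ +-monoˡ-≤ (indeg x) (*-monoʳ-≤ 2 W₁≤) ⟩
        2 * ∑ (λ c → ⟦ X c ⟧ * r c) + indeg x
          ≡⟨ cong₂ _+_ (*-distribˡ-sum 2 (λ c → ⟦ X c ⟧ * r c)) (sym (one-times (indeg x))) ⟩
        ∑ (λ c → 2 * (⟦ X c ⟧ * r c)) + ⟦ X x ⟧ * indeg x
          ≤⟨ ∑-mono-except₁ x {λ c → 2 * (⟦ X c ⟧ * r c)} {λ c → ⟦ X c ⟧ * indeg c} (λ c _ → pointwise c) ⟩
        ∑ (λ c → ⟦ X c ⟧ * indeg c) + 2 * (⟦ X x ⟧ * r x)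
          ≤⟨ +-mono-≤ (≤-trans (≤-reflexive (hits-count y (λ Xx → Xx))) (count≤n P))
               (*-monoʳ-≤ 2 (≤-trans (≤-reflexive (one-times (r x))) (r≤1 x Xx))) ⟩
        n + 2 ∎
        where
        open ≤-Reasoning
        one-times : ∀ k → ⟦ X x ⟧ * k ≡ k
        one-times k = trans (cong (_* k) (⟦⟧-true Xx)) (*-identityˡ k)
        -- On `X` this is the indicator of the image of `f`, because `f` is injective and is the
        -- only out-neighbour in `X`.
        r : Fin n → ℕ
        r c = count λ w → W₁ w ∧ G w c
        r≤1 : ∀ c → X c ≡ true → r c ≤ 1
        r≤1 c Xc = count≤1 λ i j p p′ →
          let h , ic = ∧-elim {W₁ i} p ; h′ , jc = ∧-elim {W₁ j} p′ in
          f-injective (full h) (full h′) (trans (out-X-unique (w→f (full h)) (f∈X (full h)) ic Xc)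
                                                (out-X-unique jc Xc (w→f (full h′)) (f∈X (full h′))))
        pointwise : ∀ c → 2 * (⟦ X c ⟧ * r c) ≤ ⟦ X c ⟧ * indeg c
        pointwise c with true-or-false (X c)
        ... | inj₂ h rewrite h = z≤n
        ... | inj₁ Xc rewrite Xc | *-identityˡ (r c) | *-identityˡ (indeg c) with 1 ≤? r c
        ...   | no r≱1 rewrite n<1⇒n≡0 (≰⇒> r≱1) = z≤n
        ...   | yes r≥1 with count>0 {A = λ w → W₁ w ∧ G w c} r≥1
        ...     | w , p = ≤-trans (*-monoʳ-≤ 2 (r≤1 c Xc))
          (subst (λ c → 2 ≤ indeg c)
            (out-X-unique (w→f F) (f∈X F) (proj₂ (∧-elim {W₁ w} p)) Xc) (Detours.2≤indeg-f F))
          where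
          F = full (proj₁ (∧-elim {W₁ w} p))
        W₁≤ : count W₁ ≤ ∑ λ c → ⟦ X c ⟧ * r c
        W₁≤ = begin
          count W₁
            ≤⟨ ∑-mono (λ w → via-f w (true-or-false (W₁ w))) ⟩
          ∑ (λ w → ∑ λ c → ⟦ X c ⟧ * ⟦ W₁ w ∧ G w c ⟧)
            ≡⟨ ∑-comm (λ w c → ⟦ X c ⟧ * ⟦ W₁ w ∧ G w c ⟧) ⟩
          ∑ (λ c → ∑ λ w → ⟦ X c ⟧ * ⟦ W₁ w ∧ G w c ⟧)
            ≡⟨ sum-cong-≗ (λ c → *-distribˡ-sum ⟦ X c ⟧ (λ w → ⟦ W₁ w ∧ G w c ⟧)) ⟨
          ∑ (λ c → ⟦ X c ⟧ * r c) ∎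
          where
          via-f : ∀ w → (W₁ w ≡ true) ⊎ (W₁ w ≡ false) → ⟦ W₁ w ⟧ ≤ ∑ λ c → ⟦ X c ⟧ * ⟦ W₁ w ∧ G w c ⟧
          via-f w (inj₂ h) rewrite h = z≤n
          via-f w (inj₁ h) = subst₂ _≤_
            (trans (cong₂ _*_ (⟦⟧-true (f∈X (full h))) (⟦⟧-true (∧-intro h (w→f (full h))))) (sym (⟦⟧-true h))) refl
            (term≤∑ (f (full h)) (λ c → ⟦ X c ⟧ * ⟦ W₁ w ∧ G w c ⟧))

      -- Case: some vertex has two in-neighbours in `W`

      module SomeQ≥2 {z u₁ u₂} (u₁≢u₂ : u₁ ≢ u₂) (Q₁ : Q z u₁ ≡ true) (Q₂ : Q z u₂ ≡ true) where

        -- An `x` with arcs to both `u₁` and `u₂` would form a diamond ending in `z`.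
        D≤miss+miss : D ≤ miss u₁ + miss u₂
        D≤miss+miss = ∑-mono₁₂ λ x → ⟦⟧-≤-+ λ Xx → miss-either {x} Xx λ h h′ →
          u₁≢u₂ (mid-unique h (proj₁ (∧-elim Q₁)) h′ (proj₁ (∧-elim Q₂)))

        Wu₁ : W u₁ ≡ true
        Wu₁ = proj₂ (∧-elim {G u₁ z} Q₁)

        Wu₂ : W u₂ ≡ true
        Wu₂ = proj₂ (∧-elim {G u₂ z} Q₂)

        D≤def+def+6 : D ≤ def u₁ + def u₂ + 6
        D≤def+def+6 = arith D≤miss+miss (miss≡def+q u₁) (miss≡def+q u₂) (q≤3 u₁) (q≤3 u₂)
          where
          arith : ∀ {D m₁ m₂ e₁ e₂ q₁ q₂} → D ≤ m₁ + m₂ → m₁ ≡ e₁ + q₁ → m₂ ≡ e₂ + q₂ → q₁ ≤ 3 → q₂ ≤ 3 → D ≤ e₁ + e₂ + 6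
          arith {D} {e₁ = e₁} {e₂} {q₁} {q₂} h refl refl h₁ h₂ =
            linear 0 (+-mono-≤ h (+-mono-≤ h₁ h₂)) (solve (D ∷ e₁ ∷ e₂ ∷ q₁ ∷ q₂ ∷ []))

        def+def≤d : def u₁ + def u₂ ≤ d
        def+def≤d = begin
          def u₁ + def u₂                                         ≡⟨ cong₂ _+_ (d-member Wu₁) (d-member Wu₂) ⟩
          ⟦ W u₁ ⟧ * def u₁ + ⟦ W u₂ ⟧ * def u₂                   ≤⟨ m≤n+m _ (∑ {n} (λ _ → 0)) ⟩
          ∑ {n} (λ _ → 0) + (⟦ W u₁ ⟧ * def u₁ + ⟦ W u₂ ⟧ * def u₂)
            ≤⟨ ∑-mono-except₂ {f = λ _ → 0} {λ w → ⟦ W w ⟧ * def w} u₁≢u₂ (λ _ _ _ → z≤n) ⟩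
          d + 0                                                   ≡⟨ +-identityʳ d ⟩
          d                                                       ∎
          where open ≤-Reasoning

        -- `u₁` and `u₂` alone carry at least `D − 6` of the deficiency, so
        -- `pW ≤ count W₁ + d + 8 − D`, while `kW ≤ D − 1 − d`.
        b≤W₁+7 : b ≤ count W₁ + 7
        b≤W₁+7 = arith (pW+def+def≤ u₁≢u₂ Wu₁ Wu₂) D≤def+def+6 pW+kW pX-large pX≤D
          where
          arith : ∀ {pw e c d D kw b x} → pw + e ≤ c + d + 2 → D ≤ e + 6 → pw + kw ≡ b → kw + 1 + d ≤ x → x ≤ D → b ≤ c + 7
          arith {pw} {e} {c} {d} {D} {kw} {x = x} h₁ h₂ refl h₃ h₄ =
            linear 0 (+-mono-≤ (+-mono-≤ h₁ h₂) (+-mono-≤ h₃ h₄)) (solve (pw ∷ e ∷ c ∷ d ∷ D ∷ kw ∷ x ∷ []))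

        abstract
          3≤W₁ : 3 ≤ count W₁
          3≤W₁ = *-cancelˡ-≤ 2 (arith b≤W₁+7 D+32≤2b 12≤D)
            where
            arith : ∀ {b c D} → b ≤ c + 7 → D + 32 ≤ 2 * b → 12 ≤ D → 2 * 3 ≤ 2 * c
            arith {b} {c} {D} h₁ h₂ h₃ = linear 24 (+-mono-≤ (scale 2 h₁) (+-mono-≤ h₂ h₃)) (solve (b ∷ c ∷ D ∷ []))

        q≤1 : ∀ {w} → W₁ w ≡ true → q w ≤ 1
        q≤1 {w} h with 2 ≤? q w
        ... | no ≱2 = ≤-pred (≰⇒> ≱2)
        ... | yes ≥2 with Detours.popular (full h) ≥2
        -- Doubling `2W₁+indeg≤n+2` and inserting `2 * indeg x > D` and `count W₁ ≥ b − 7` gives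
        -- `2 * b < D + 32`.
        ...   | x , Xx , big = ⊥-elim (n≮0 (arith (2W₁+indeg≤n+2 Xx) big b≤W₁+7 D+32≤2b D+b≡n))
          where
          arith : ∀ {c i n D b} → 2 * c + i ≤ n + 2 → D < 2 * i → b ≤ c + 7 → D + 32 ≤ 2 * b → D + b ≡ n → 1 ≤ 0
          arith {c} {i} {D = D} {b} h₁ h₂ h₃ h₄ refl =
            linear 0 (+-mono-≤ (+-mono-≤ (scale 2 h₁) h₂) (+-mono-≤ (scale 4 h₃) h₄)) (solve (c ∷ i ∷ D ∷ b ∷ []))

        not-three : ∀ {w₁ w₂ w₃} → W₁ w₁ ≡ true → W₁ w₂ ≡ true → W₁ w₃ ≡ true → w₁ ≢ w₂ → w₁ ≢ w₃ → ¬ w₂ ≢ w₃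
        -- `triple` gives `2 * pX ≤ d + 9`, so `d ≤ 5` and `D ≤ d + 6 ≤ 11`.
        not-three h₁ h₂ h₃ ≢₁₂ ≢₁₃ ≢₂₃ = n≮0 (arith
          (triple F₁ F₂ F₃ ≢₁₂ ≢₁₃ ≢₂₃ (q≤1 h₁) (q≤1 h₂) (q≤1 h₃))
          (q≤3 (u F₁)) (q≤3 (u F₂)) (q≤3 (u F₃)) d+2≤pX D≤def+def+6 def+def≤d 12≤D)
          where
          F₁ = full h₁
          F₂ = full h₂
          F₃ = full h₃
          arith : ∀ {x d q₁ q₂ q₃ D e} → 2 * x ≤ d + (q₁ + q₂ + q₃) → q₁ ≤ 3 → q₂ ≤ 3 → q₃ ≤ 3 → d + 2 ≤ x →
                  D ≤ e + 6 → e ≤ d → 12 ≤ D → 1 ≤ 0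
          arith {x} {d} {q₁} {q₂} {q₃} {D} {e} h h₁ h₂ h₃ h₄ h₅ h₆ h₇ =
            linear 0 (+-mono-≤ (+-mono-≤ h h₁) (+-mono-≤ (+-mono-≤ h₂ h₃) (+-mono-≤ (scale 2 h₄) (+-mono-≤ h₅ (+-mono-≤ h₆ h₇)))))
              (solve (x ∷ d ∷ q₁ ∷ q₂ ∷ q₃ ∷ D ∷ e ∷ []))

        impossible : ⊥
        impossible with count>0 {A = W₁} W₁-nonempty
        ... | w₁ , h₁ with count-avoid₁ {A = W₁} w₁ (<⇒≤ 3≤W₁)
        ...   | w₂ , h₂ , w₂≢w₁ with count-avoid₂ {A = W₁} w₂≢w₁ 3≤W₁
        ...     | w₃ , h₃ , w₃≢w₂ , w₃≢w₁ = not-three h₁ h₂ h₃ (w₂≢w₁ ∘ sym) (w₃≢w₁ ∘ sym) (w₃≢w₂ ∘ sym)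

      impossible : ⊥
      impossible with any? (λ z → 2 ≤? q z)
      ... | no none = AllQ≤1.impossible λ z → ≤-pred (≰⇒> λ h → none (z , h))
      ... | yes (z , 2≤q) with count>0 {A = Q z} (<⇒≤ 2≤q)
      ...   | u₁ , Q₁ with count-avoid₁ {A = Q z} u₁ 2≤q
      ...     | u₂ , Q₂ , u₂≢u₁ = SomeQ≥2.impossible u₂≢u₁ Q₂ Q₁

-- Arc counts as sums and the formula for the maximum

argmax : ∀ (f : Fin (suc n) → ℕ) → ∃[ y ] ∀ v → f v ≤ f y
argmax {zero}  f = zero , λ { zero → ≤-refl }
argmax {suc n} f with argmax (f ∘ suc)
... | y , max with ≤-total (f zero) (f (suc y))
...   | inj₁ ≤y = suc y , λ { zero → ≤y ; (suc v) → max v }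
...   | inj₂ y≤ = zero , λ { zero → ≤-refl ; (suc v) → ≤-trans (max v) y≤ }

length-filter-tabulate : ∀ {A : Set} {k} (p : A → Bool) (g : Fin k → A) →
                         length (filter (λ a → T? (p a)) (tabulate g)) ≡ count (p ∘ g)
length-filter-tabulate {k = zero}  p g = refl
length-filter-tabulate {k = suc k} p g with p (g zero)
... | true  = cong suc (length-filter-tabulate p (g ∘ suc))
... | false = length-filter-tabulate p (g ∘ suc)

sum-map-tabulate : ∀ {A : Set} {k} (h : A → ℕ) (g : Fin k → A) → listSum (map h (tabulate g)) ≡ ∑ (h ∘ g)
sum-map-tabulate {k = zero}  h g = refl
sum-map-tabulate {k = suc k} h g = cong (h (g zero) +_) (sum-map-tabulate h (g ∘ suc))

arcCount≡∑ : ∀ (G : Digraph n) → arcCount G ≡ ∑ λ u → count (G u)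
arcCount≡∑ G = trans (sum-map-tabulate (λ u → length (filter (λ v → T? (G u v)) (allFin _))) (λ u → u))
  (sum-cong-≗ λ u → length-filter-tabulate (G u) (λ v → v))

4st≤[s+t]² : ∀ s t → 4 * (s * t) ≤ (s + t) * (s + t)
4st≤[s+t]² s t with ≤-total s t
... | inj₁ s≤t with m≤n⇒∃[o]m+o≡n s≤t
...   | o , refl = linear 0 (z≤n {o * o}) (solve (s ∷ o ∷ []))
4st≤[s+t]² s t | inj₂ t≤s with m≤n⇒∃[o]m+o≡n t≤s
...   | o , refl = linear 0 (z≤n {o * o}) (solve (t ∷ o ∷ []))

parity : ∀ n → (∃[ m ] n ≡ m * 2) ⊎ (∃[ m ] n ≡ 1 + m * 2)
parity zero = inj₁ (0 , refl)
parity (suc n) with parity n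
... | inj₁ (m , refl) = inj₂ (m , refl)
... | inj₂ (m , refl) = inj₁ (suc m , refl)

[1+m*2]/2≡m : ∀ m → (1 + m * 2) / 2 ≡ m
[1+m*2]/2≡m m = trans (+-distrib-/-∣ʳ 1 {m * 2} {2} (n∣m*n m)) (m*n/n≡m m 2)

[1+m*4]/4≡m : ∀ m → (1 + m * 4) / 4 ≡ m
[1+m*4]/4≡m m = trans (+-distrib-/-∣ʳ 1 {m * 4} {4} (n∣m*n m)) (m*n/n≡m m 4)

ex : ℕ → ℕ
ex n = (n * n) / 4 + (n + 1) / 2

ex-even : ∀ m → ex (m * 2) ≡ m * m + m
ex-even m = cong₂ _+_
  (trans (cong (_/ 4) {m * 2 * (m * 2)} {m * m * 4} (solve (m ∷ []))) (m*n/n≡m (m * m) 4))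
  (trans (cong (_/ 2) (+-comm (m * 2) 1)) ([1+m*2]/2≡m m))

ex-odd : ∀ m → ex (1 + m * 2) ≡ (m * m + m) + (1 + m)
ex-odd m = cong₂ _+_
  (trans (cong (_/ 4) {(1 + m * 2) * (1 + m * 2)} {1 + (m * m + m) * 4} (solve (m ∷ []))) ([1+m*4]/4≡m (m * m + m)))
  (trans (cong (_/ 2) {1 + m * 2 + 1} {(1 + m) * 2} (solve (m ∷ []))) (m*n/n≡m (1 + m) 2))

-- `ex n` is `⌊(n + 1)² / 4⌋`. The first bound serves to show that `D` and `b` are close, the second
-- to bound products with factor sum `n + 1`.
ex-bounds : ∀ n → n * n + 2 * n ≤ 4 * ex n × (n + 1) * (n + 1) ≤ 4 * ex n + 1
ex-bounds n with parity n
... | inj₁ (m , refl) rewrite ex-even m =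
  ≤-reflexive (solve (m ∷ [])) , ≤-reflexive (solve (m ∷ []))
... | inj₂ (m , refl) rewrite ex-odd m =
  linear 1 (≤-refl {0}) (solve (m ∷ [])) , linear 1 (≤-refl {0}) (solve (m ∷ []))

st≤ex : ∀ n s t → s + t ≡ n + 1 → s * t ≤ ex n
st≤ex n s t s+t≡n+1 = ≤-pred (*-cancelˡ-< 4 (s * t) (suc (ex n)) (begin-strict
  4 * (s * t)          ≤⟨ 4st≤[s+t]² s t ⟩
  (s + t) * (s + t)    ≡⟨ cong₂ _*_ s+t≡n+1 s+t≡n+1 ⟩
  (n + 1) * (n + 1)    ≤⟨ proj₂ (ex-bounds n) ⟩
  4 * ex n + 1         <⟨ arith (ex n) ⟩
  4 * suc (ex n)       ∎))
  where
  open ≤-Reasoning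
  arith : ∀ e → suc (4 * e + 1) ≤ 4 * suc e
  arith e = linear 2 (≤-refl {0}) (solve (e ∷ []))

-- Near-equality of `D` and `b`

-- `close` says `(D − b)² + 4 ≤ 2 * (D + b)`. The threshold 200 is a round number; its tightest use
-- is `x≥31`.
module Balanced {D b} (n≥200 : 200 ≤ D + b) (close : (D + b) * (D + b) + 4 ≤ 4 * (D * b) + 2 * (D + b)) where

  b≤2D+1 : b ≤ 2 * D + 1
  b≤2D+1 with b ≤? 2 * D + 1
  ... | yes le = le
  ... | no ≰ with m≤n⇒∃[o]m+o≡n (≰⇒> ≰)
  ...   | t , eq = ⊥-elim (n≮0 (arith D t (subst (λ b → (D + b) * (D + b) + 4 ≤ 4 * (D * b) + 2 * (D + b)) (sym eq) close)))
    where
    arith : ∀ D t → let b = suc (2 * D + 1) + t in (D + b) * (D + b) + 4 ≤ 4 * (D * b) + 2 * (D + b) → 1 ≤ 0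
    -- With `b = 2D + 2 + t`, `close` reads `(D + 2 + t)² + 4 ≤ 2 * (3D + 2 + t)`. The case split
    -- absorbs the term `−2D` in the difference.
    arith zero    t h = linear (t * t + 2 * t + 3) h (solve (t ∷ []))
    arith (suc D) t h = linear (D * D + t * t + 4 * t + 2 * (D * t) + 2) h (solve (D ∷ t ∷ []))

  D+32≤2b : D + 32 ≤ 2 * b
  D+32≤2b with D + 32 ≤? 2 * b | ≤-total D b
  ... | yes le | _ = le
  ... | no _ | inj₁ D≤b = arith n≥200 D≤b
    where
    arith : ∀ {D b} → 200 ≤ D + b → D ≤ b → D + 32 ≤ 2 * b
    arith {D} {b} h g = *-cancelˡ-≤ 2 (linear 136 (+-mono-≤ h (scale 3 g)) (solve (D ∷ b ∷ [])))
  ... | no ≰ | inj₂ b≤D with m≤n⇒∃[o]m+o≡n b≤D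
  ...   | x , refl = ⊥-elim (n≮0 (too-far {x} {b} (x≥31 {x} {b} n≥200 2b≤) 2b≤ close))
    where
    2b≤ : 2 * b ≤ b + x + 31
    2b≤ = ≤-pred (≤-trans (≰⇒> ≰) (≤-reflexive (+-suc (b + x) 31)))
    x≥31 : ∀ {x b} → 200 ≤ b + x + b → 2 * b ≤ b + x + 31 → 31 ≤ x
    x≥31 {x} {b} h₁ h₂ = *-cancelˡ-≤ 3 (linear 45 (+-mono-≤ h₁ (scale 2 h₂)) (solve (x ∷ b ∷ [])))
    too-far : ∀ {x b} → 31 ≤ x → 2 * b ≤ b + x + 31 →
              (b + x + b) * (b + x + b) + 4 ≤ 4 * ((b + x) * b) + 2 * (b + x + b) → 1 ≤ 0
    -- `close` gives `x² + 4 ≤ 4b + 2x ≤ 6x + 124`, while `x ≥ 31` gives `x² ≥ 10x` and `4x ≥ 124`.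
    too-far {x} {b} h₁ h₂ h₃ =
      linear 3 (+-mono-≤ (+-mono-≤ (scale 4 h₂) h₃) (+-mono-≤ (scale 4 h₁) 10x≤x²))
        (solve (x ∷ b ∷ []))
      where
      10x≤x² : 10 * x ≤ x * x
      10x≤x² = *-monoˡ-≤ x (≤-trans (m≤m+n 10 21) h₁)

  12≤D : 12 ≤ D
  12≤D = *-cancelˡ-≤ 3 (arith n≥200 b≤2D+1)
    where
    arith : ∀ {D b} → 200 ≤ D + b → b ≤ 2 * D + 1 → 3 * 12 ≤ 3 * D
    arith {D} {b} h g = linear 163 (+-mono-≤ h g) (solve (D ∷ b ∷ []))

-- Upper bound

no-diamond⇒≤ex : ∀ {n} (G : Digraph n) → 200 ≤ n → IsOriented G → ¬ ContainsF G → arcCount G ≤ ex n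
no-diamond⇒≤ex {suc n} G n≥200 (loopless , antisymmetric) F-free with arcCount G ≤? ex (suc n)
... | yes le = le
... | no ≰ = ⊥-elim impossible
  where
  no-loop : ∀ {v} → ¬ G v v ≡ true
  no-loop {v} vv = true≢false vv (loopless v)

  no-2-cycle : ∀ {u v} → G u v ≡ true → ¬ G v u ≡ true
  no-2-cycle {u} {v} uv vu = true≢false vu (antisymmetric u v uv)

  no-loop-≢ : ∀ {u v} → G u v ≡ true → u ≢ v
  no-loop-≢ uv refl = no-loop uv

  mid-unique : ∀ {x y₁ y₂ z} → G x y₁ ≡ true → G y₁ z ≡ true → G x y₂ ≡ true → G y₂ z ≡ true → y₁ ≡ y₂
  mid-unique {x} {y₁} {y₂} {z} xy₁ y₁z xy₂ y₂z with y₁ ≟ y₂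
  ... | yes eq = eq
  ... | no y₁≢y₂ = contradiction
    (x , y₁ , y₂ , z , no-loop-≢ xy₁ , no-loop-≢ xy₂ , x≢z , y₁≢y₂ , no-loop-≢ y₁z , no-loop-≢ y₂z , xy₁ , xy₂ , y₁z , y₂z)
    F-free
    where
    x≢z : x ≢ z
    x≢z refl = no-2-cycle xy₁ y₁z

  open NoDiamond G no-loop no-2-cycle mid-unique
  y = proj₁ (argmax indeg)
  open MaxIndegree y (proj₂ (argmax indeg))

  arcs-large : ex (suc n) < arcs
  arcs-large = subst (ex (suc n) <_) (trans (arcCount≡∑ G) (∑-comm λ u v → ⟦ G u v ⟧)) (≰⇒> ≰)

  st<arcs : ∀ s t → s + t ≡ suc n + 1 → s * t < arcs
  st<arcs s t eq = ≤-trans (s≤s (st≤ex (suc n) s t eq)) arcs-large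

  -- Combines `n² + 2n ≤ 4 * ex n < 4 * arcs` with `arcs ≤ D * b + n`; strictness supplies the 4.
  close : (D + b) * (D + b) + 4 ≤ 4 * (D * b) + 2 * (D + b)
  close = arith {D = D} {b} (proj₁ (ex-bounds (suc n))) arcs-large arcs+d (count≤n P) D+b≡n
    where
    arith : ∀ {D b n e a d p} → n * n + 2 * n ≤ 4 * e → e < a → a + d ≡ D * b + p → p ≤ n → D + b ≡ n →
            (D + b) * (D + b) + 4 ≤ 4 * (D * b) + 2 * (D + b)
    arith {D} {b} {e = e} {a} {d} {p} h₁ h₂ h₃ h₄ refl =
      linear (4 * d) (+-mono-≤ (+-mono-≤ h₁ (scale 4 h₂)) (+-mono-≤ (scale 4 (≤-reflexive h₃)) (scale 4 h₄)))
        (solve (e ∷ a ∷ d ∷ p ∷ D ∷ b ∷ []))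

  impossible : ⊥
  impossible = Dense.impossible
    (subst (_< arcs) (+-comm b (D * b)) (st<arcs (suc D) b (trans (cong suc D+b≡n) (+-comm 1 (suc n)))))
    (subst (_< arcs) (trans (*-suc D b) (+-comm D (D * b)))
      (st<arcs D (suc b) (trans (+-suc D b) (trans (cong suc D+b≡n) (+-comm 1 (suc n))))))
    b≤2D+1 D+32≤2b 12≤D
    where open Balanced {D} {b} (subst (200 ≤_) (sym D+b≡n) n≥200) close

-- Extremal construction

count-<ᵇ : ∀ {n} k → k ≤ n → count {n} (λ i → toℕ i <ᵇ k) ≡ k
count-<ᵇ {n}     zero    _         = ∑-zero n
count-<ᵇ {suc n} (suc k) (s≤s k≤n) = cong suc (count-<ᵇ k k≤n)

count-≡ : ∀ (w : Fin n) → count (λ v → does (v ≟ w)) ≡ 1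
count-≡ {suc n} zero    = cong suc (∑-zero n)
count-≡ {suc n} (suc w) = count-≡ w

-- All arcs from A = {0, …, k−1} to its complement, plus one arc u → next u inside A for each u in A.
module Construction (n k : ℕ) (3≤k : 3 ≤ k) (k≤3+n : k ≤ 3 + n) where

  V : Set
  V = Fin (3 + n)

  -- A directed triangle with all other vertices pointing at 0: no fixed point, no 2-cycle, and
  -- values in `A` because `k ≥ 3`.
  next : V → V
  next zero          = suc zero
  next (suc zero)    = suc (suc zero)
  next (suc (suc _)) = zero

  A : V → Bool
  A v = toℕ v <ᵇ k

  G : Digraph (3 + n)
  G u v = A u ∧ (not (A v) ∨ does (v ≟ next u))

  A-next : ∀ u → A (next u) ≡ true
  A-next = go 3≤k
    where
    go : ∀ {k} → 3 ≤ k → ∀ u → (toℕ (next u) <ᵇ k) ≡ true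
    go (s≤s (s≤s (s≤s _))) zero          = refl
    go (s≤s (s≤s (s≤s _))) (suc zero)    = refl
    go (s≤s (s≤s (s≤s _))) (suc (suc _)) = refl

  tail∈A : ∀ {u v} → G u v ≡ true → A u ≡ true
  tail∈A uv = proj₁ (∧-elim uv)

  head≡next : ∀ {u v} → G u v ≡ true → A v ≡ true → v ≡ next u
  head≡next {u} {v} uv Av with v ≟ next u | ∧-elim {A u} uv
  ... | yes eq | _ = eq
  ... | no _   | _ , h rewrite Av = true≢false h refl

  next-≢ : ∀ u → u ≢ next u
  next-≢ zero          ()
  next-≢ (suc zero)    ()
  next-≢ (suc (suc _)) ()

  next²-≢ : ∀ u → u ≢ next (next u)
  next²-≢ zero          ()
  next²-≢ (suc zero)    ()
  next²-≢ (suc (suc _)) ()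

  oriented : IsOriented G
  oriented = (λ u → ≢true (λ uu → next-≢ u (head≡next uu (tail∈A uu)))) , λ u v uv → ≢true λ vu →
    next²-≢ u (trans (head≡next vu (tail∈A uv)) (cong next (head≡next uv (tail∈A vu))))
    where
    ≢true : ∀ {b} → ¬ b ≡ true → b ≡ false
    ≢true {true}  h = contradiction refl h
    ≢true {false} h = refl

  -- Being tails, `y₁` and `y₂` lie in `A`, so as heads of arcs from `x` both equal `next x`.
  F-free : ¬ ContainsF G
  F-free (x , y₁ , y₂ , z , _ , _ , _ , y₁≢y₂ , _ , _ , xy₁ , xy₂ , y₁z , y₂z) =
    y₁≢y₂ (trans (head≡next xy₁ (tail∈A y₁z)) (sym (head≡next xy₂ (tail∈A y₂z))))

  count-not-A : count (not ∘ A) ≡ 3 + n ∸ k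
  count-not-A = begin
    count (not ∘ A)                      ≡⟨ m+n∸m≡n (count A) _ ⟨
    count A + count (not ∘ A) ∸ count A  ≡⟨ cong₂ _∸_ (count-not A) (count-<ᵇ k k≤3+n) ⟩
    3 + n ∸ k                            ∎
    where open ≡-Reasoning

  outdegree : ∀ u → count (G u) ≡ ⟦ A u ⟧ * (3 + n ∸ k + 1)
  outdegree u = begin
    count (G u)
      ≡⟨ sum-cong-≗ (λ v → trans (⟦∧⟧ (A u) _) (cong (⟦ A u ⟧ *_) (disjoint v))) ⟩
    ∑ (λ v → ⟦ A u ⟧ * (⟦ not (A v) ⟧ + ⟦ does (v ≟ next u) ⟧))
      ≡⟨ *-distribˡ-sum ⟦ A u ⟧ (λ v → ⟦ not (A v) ⟧ + ⟦ does (v ≟ next u) ⟧) ⟨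
    ⟦ A u ⟧ * ∑ (λ v → ⟦ not (A v) ⟧ + ⟦ does (v ≟ next u) ⟧)
      ≡⟨ cong (⟦ A u ⟧ *_) (trans (∑-distrib-+ (λ v → ⟦ not (A v) ⟧) (λ v → ⟦ does (v ≟ next u) ⟧)) (cong₂ _+_ count-not-A (count-≡ (next u)))) ⟩
    ⟦ A u ⟧ * (3 + n ∸ k + 1) ∎
    where
    open ≡-Reasoning
    disjoint : ∀ v → ⟦ not (A v) ∨ does (v ≟ next u) ⟧ ≡ ⟦ not (A v) ⟧ + ⟦ does (v ≟ next u) ⟧
    disjoint v with v ≟ next u
    ... | no _ rewrite Bool.∨-identityʳ (not (A v)) = sym (+-identityʳ _)
    ... | yes refl rewrite A-next u = refl

  arcCount≡ : arcCount G ≡ k * (3 + n ∸ k + 1)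
  arcCount≡ = begin
    arcCount G                                   ≡⟨ arcCount≡∑ G ⟩
    ∑ (λ u → count (G u))                        ≡⟨ sum-cong-≗ outdegree ⟩
    ∑ (λ u → ⟦ A u ⟧ * (3 + n ∸ k + 1))          ≡⟨ *-distribʳ-sum (3 + n ∸ k + 1) (λ u → ⟦ A u ⟧) ⟨
    count A * (3 + n ∸ k + 1)                    ≡⟨ cong (_* (3 + n ∸ k + 1)) (count-<ᵇ k k≤3+n) ⟩
    k * (3 + n ∸ k + 1)                          ∎
    where open ≡-Reasoning

ex-attained : ∀ {n} s t → 3 ≤ s → n ≡ t + s → s * (t + 1) ≡ ex n →
              ∃[ G ] (IsOriented {n} G × ¬ ContainsF G × arcCount G ≡ ex n)
ex-attained {n} s t 3≤s n≡t+s eq with m≤n⇒∃[o]m+o≡n (≤-trans 3≤s (≤-trans (m≤n+m s t) (≤-reflexive (sym n≡t+s))))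
... | n′ , refl = G , oriented , F-free ,
  trans arcCount≡ (trans (cong (λ r → s * (r + 1)) (trans (cong (_∸ s) n≡t+s) (m+n∸n≡m t s))) eq)
  where open Construction n′ s 3≤s (≤-trans (m≤n+m s t) (≤-reflexive (sym n≡t+s)))

-- The factors of `s * (t + 1)` sum to `n + 1`, so they are taken as equal as possible: `m` and
-- `m + 1`, or `m + 1` twice.
lower-bound : ∀ n → 200 ≤ n → ∃[ G ] (IsOriented {n} G × ¬ ContainsF G × arcCount G ≡ ex n)
lower-bound n n≥200 with parity n
... | inj₁ (m , refl) = ex-attained {m * 2} m m (*-cancelʳ-≤ 3 m 2 (≤-trans (m≤m+n 6 194) n≥200)) (solve (m ∷ []))
  (trans {j = m * m + m} (solve (m ∷ [])) (sym (ex-even m)))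
... | inj₂ (m , refl) = ex-attained {1 + m * 2} (1 + m) m (*-cancelʳ-≤ 3 (1 + m) 2 (≤-trans (m≤m+n 6 194) (≤-trans n≥200 (n≤1+n _))))
  (solve (m ∷ []))
  (trans {j = (m * m + m) + (1 + m)} (solve (m ∷ [])) (sym (ex-odd m)))

theorem3p2 : ∃[ N ] ((n : ℕ) → n ≥ N → ExOriF≡ n ((n * n) / 4 + (n + 1) / 2))
theorem3p2 = 200 , λ n n≥200 → lower-bound n n≥200 , λ G → no-diamond⇒≤ex G n≥200
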